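{- For every integer $n\ge 1$, $$\mathrm{Pnest}_n(t)=\sum_{i=1}^{\lceil n/2\rceil}\bigl[H(n,2i-1)+H(n,2i)\bigr]t^i\qquad\text{and}\qquad \mathrm{Pnest}^c_n(t)=\sum_{i=1}^{\lceil n/2\rceil}\bigl[H(n-1,2i-2)+H(n-1,2i-1)\bigr]t^i,$$ where $\mathrm{Pnest}_n(t)=\sum_{\mathbf a\in\mathcal{DP}(n)}t^{\mathrm{pnest}(\mathbf a)}$, $\mathrm{Pnest}^c_n(t)$ is the same sum restricted to those $\mathbf a\in\mathcal{DP}(n)$ for which $\Gamma_{\mathbf a}$ is connected, and $H(m,k)$ is the number of Dyck paths of semilength $m$ and height $k$.
   Context: Write $[n]=\{1,\dots,n\}$. An area sequence of size $n$ is a sequence $\mathbf a=(a_1,\dots,a_n)$ of nonnegative integers with $a_i<i$ for all $i$ and $a_i\le a_{i-1}+1$ for all $i\ge 2$; $\mathcal{DP}(n)$ is the set of all of them. Each $\mathbf a\in\mathcal{DP}(n)$ defines a graph $\Gamma_{\mathbf a}$ (a unit interval graph) on $[n]$ with edges $\{j,i\}$ for $1\le j<i\le n$ with $i-a_i\le j$. If $\{i,j\}$ with $i<j$ is an edge then $\{i,i+1,\dots,j\}$ is a clique. A peak-edge of $\Gamma_{\mathbf a}$ is either an isolated vertex $i$ (put $j=i$) or an edge $\{i,j\}$, $i<j$, such that neither $\{i,j+1\}$ nor $\{i-1,j\}$ is an edge (pairs not contained in $[n]$ are not edges). The corresponding peak-clique is $\{i,i+1,\dots,j\}$. The peak-nesting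 of a vertex is the number of peak-cliques containing it, and $\mathrm{pnest}(\mathbf a)$ is the maximum of these numbers over all vertices. A Dyck path of semilength $m$ is a lattice path from $(0,0)$ to $(2m,0)$ with steps $U=(1,1)$, $D=(1,-1)$ never going below the $x$-axis; its height is the largest $y$-coordinate attained. Conventions: $H(0,0)=1$ (the empty path has height 0), $H(m,k)=0$ if $k>m$, and $H(m,0)=0$ for $m\ge1$. -}

module Defs where

open import Data.Bool.Base using (if_then_else_)
open import Data.Fin.Base using (Fin; toℕ)
import Data.Fin.Base as Fin
import Data.Fin.Properties as Fin
open import Data.Integer.Base using (ℤ; +_; 0ℤ; 1ℤ; -1ℤ)
import Data.Integer.Base as ℤ
import Data.Integer.Properties as ℤ
open import Data.List.Base
  using (List; []; _∷_; length; map; foldr; filter; upTo; allFin; cartesianProduct; cartesianProductWith)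
open import Data.List.Relation.Unary.All using (All; all?)
open import Data.List.Extrema.Nat using () renaming (max to maxℕ)
open import Data.List.Extrema ℤ.≤-totalOrder using () renaming (max to maxℤ)
open import Data.Nat.Base using (ℕ; zero; suc; _+_; _*_; _∸_; _≤_; _<_)
import Data.Nat.Properties as ℕ
open import Data.Product.Base using (_×_; _,_)
open import Data.Sum.Base using (_⊎_; inj₁; inj₂)
open import Data.Vec.Base using (Vec; []; _∷_; lookup)
open import Relation.Binary.Construct.Closure.ReflexiveTransitive using (Star; ε; _◅_; _◅◅_)
open import Relation.Binary.PropositionalEquality.Core using (_≡_; refl; sym; trans)
open import Relation.Nullary.Decidable
  using (Dec; yes; no; does; ¬?; map′; _×-dec_; _⊎-dec_; _→-dec_)
open import Relation.Nullary.Negation using (¬_)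

-- The words of length n over the alphabet xs, each occurring exactly once
-- when xs has no repetitions.
words : ∀ {A : Set} → List A → (n : ℕ) → List (Vec A n)
words xs zero    = [] ∷ []
words xs (suc n) = cartesianProductWith _∷_ xs (words xs n)

------------------------------------------------------------------------
-- Area sequences

-- Fin n stands for {1,…,n}: the element x has label suc (toℕ x).
label : ∀ {n} → Fin n → ℕ
label x = suc (toℕ x)

IsAreaSequence : ∀ {n} → Vec ℕ n → Set
IsAreaSequence {n} a =
    (∀ (i : Fin n) → lookup a i < label i)
  × (∀ (h i : Fin n) → label i ≡ suc (label h) → lookup a i ≤ lookup a h + 1)

isAreaSequence? : ∀ {n} (a : Vec ℕ n) → Dec (IsAreaSequence a)
isAreaSequence? a =
  Fin.all? (λ i → lookup a i ℕ.<? label i)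
  ×-dec
  Fin.all? (λ h → Fin.all? (λ i →
    (label i ℕ.≟ suc (label h)) →-dec (lookup a i ℕ.≤? lookup a h + 1)))

-- The entries of an area sequence of size n are all smaller than n, so
-- no area sequence is missed by restricting to words over {0,…,n-1}.
DP : (n : ℕ) → List (Vec ℕ n)
DP n = filter isAreaSequence? (words (upTo n) n)

------------------------------------------------------------------------
-- The unit interval graph of an area sequence

module _ {n : ℕ} (a : Vec ℕ n) where

  -- For an area sequence the subtraction is never truncated.
  Edge< : Fin n → Fin n → Set
  Edge< j i = (j Fin.< i) × (label i ∸ lookup a i ≤ label j)

  Edge : Fin n → Fin n → Set
  Edge x y = Edge< x y ⊎ Edge< y x

  Isolated : Fin n → Set
  Isolated x = ∀ y → ¬ Edge x y

  -- Quantifying over k ∈ [n] with k = j + 1 (resp. k = i - 1) makes pairs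
  -- not contained in [n] count as non-edges.
  PeakEdge : Fin n → Fin n → Set
  PeakEdge i j =
      (i ≡ j × Isolated i)
    ⊎ ( (i Fin.< j) × Edge i j
      × (∀ k → label k ≡ suc (label j) → ¬ Edge i k)
      × (∀ k → suc (label k) ≡ label i → ¬ Edge k j) )

  Connected : Set
  Connected = ∀ x y → Star Edge x y

  edge<? : ∀ j i → Dec (Edge< j i)
  edge<? j i = (j Fin.<? i) ×-dec (label i ∸ lookup a i ℕ.≤? label j)

  edge? : ∀ x y → Dec (Edge x y)
  edge? x y = edge<? x y ⊎-dec edge<? y x

  peakEdge? : ∀ i j → Dec (PeakEdge i j)
  peakEdge? i j =
    ((i Fin.≟ j) ×-dec Fin.all? (λ y → ¬? (edge? i y)))
    ⊎-dec
    ( (i Fin.<? j) ×-dec edge? i j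
      ×-dec Fin.all? (λ k → (label k ℕ.≟ suc (label j)) →-dec ¬? (edge? i k))
      ×-dec Fin.all? (λ k → (suc (label k) ℕ.≟ label i) →-dec ¬? (edge? k j)) )

  -- The peak-clique of a peak-edge (i , j) is the interval {i,…,j}.
  -- Since i ≤ j, distinct peak-edges have distinct peak-cliques, and
  -- peak-cliques are counted by counting pairs (i , j).
  InPeakClique : Fin n → Fin n × Fin n → Set
  InPeakClique v (i , j) = PeakEdge i j × (i Fin.≤ v) × (v Fin.≤ j)

  inPeakClique? : ∀ v ij → Dec (InPeakClique v ij)
  inPeakClique? v (i , j) = peakEdge? i j ×-dec (i Fin.≤? v) ×-dec (v Fin.≤? j)

  peakNesting : Fin n → ℕ
  peakNesting v = length (filter (inPeakClique? v) (cartesianProduct (allFin n) (allFin n)))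

  pnest : ℕ
  pnest = maxℕ 0 (map peakNesting (allFin n))

------------------------------------------------------------------------
-- Reachability in a finite decidable graph is decidable (Floyd–Warshall)

module Reachability {n : ℕ} {E : Fin n → Fin n → Set} (E? : ∀ x y → Dec (E x y)) where

  -- Via k x y: x and y are joined by a walk whose inner vertices are
  -- among the first k vertices.
  data Via : ℕ → Fin n → Fin n → Set where
    here : ∀ {x y} → x ≡ y → Via 0 x y
    edge : ∀ {x y} → E x y → Via 0 x y
    skip : ∀ {k x y} → Via k x y → Via (suc k) x y
    via  : ∀ {k x y} (w : Fin n) → toℕ w ≡ k → Via k x w → Via k w y → Via (suc k) x y

  via? : ∀ k x y → Dec (Via k x y)
  via? zero    x y = map′ (λ { (inj₁ p) → here p ; (inj₂ e) → edge e })
                          (λ { (here p) → inj₁ p ; (edge e) → inj₂ e })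
                          ((x Fin.≟ y) ⊎-dec E? x y)
  via? (suc k) x y =
    map′ (λ { (inj₁ p) → skip p ; (inj₂ (w , e , p , q)) → via w e p q })
         (λ { (skip p) → inj₁ p ; (via w e p q) → inj₂ (w , e , p , q) })
         (via? k x y ⊎-dec
          Fin.any? (λ w → (toℕ w ℕ.≟ k) ×-dec via? k x w ×-dec via? k w y))

  to : ∀ {k x y} → Via k x y → Star E x y
  to (here refl)   = ε
  to (edge e)      = e ◅ ε
  to (skip p)      = to p
  to (via _ _ p q) = to p ◅◅ to q

  toPivot : ∀ {k x w} → toℕ w ≡ k → Via (suc k) x w → Via k x w
  toPivot _ (skip p) = p
  toPivot e (via w′ e′ p _) with refl ← Fin.toℕ-injective (trans e′ (sym e)) = p

  fromPivot : ∀ {k w y} → toℕ w ≡ k → Via (suc k) w y → Via k w y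
  fromPivot _ (skip p) = p
  fromPivot e (via w′ e′ _ q) with refl ← Fin.toℕ-injective (trans e′ (sym e)) = q

  join : ∀ {k x w y} → toℕ w < k → Via k x w → Via k w y → Via k x y
  join {suc k} {w = w} w<1+k p q with toℕ w ℕ.≟ k
  ... | yes w≡k = via w w≡k (toPivot w≡k p) (fromPivot w≡k q)
  ... | no  w≢k = go p q
    where
    w<k : toℕ w < k
    w<k = ℕ.≤∧≢⇒< (ℕ.≤-pred w<1+k) w≢k
    go : ∀ {x y} → Via (suc k) x w → Via (suc k) w y → Via (suc k) x y
    go (skip p)        (skip q)        = skip (join w<k p q)
    go (skip p)        (via v e q₁ q₂) = via v e (join w<k p q₁) q₂
    go (via v e p₁ p₂) (skip q)        = via v e p₁ (join w<k p₂ q)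
    go (via v e p₁ _) (via v′ e′ _ q₂)
      with refl ← Fin.toℕ-injective (trans e′ (sym e)) = via v e p₁ q₂

  raise : ∀ k {x y} → Via 0 x y → Via k x y
  raise zero    p = p
  raise (suc k) p = skip (raise k p)

  from : ∀ {x y} → Star E x y → Via n x y
  from ε        = raise n (here refl)
  from (e ◅ es) = join (Fin.toℕ<n _) (raise n (edge e)) (from es)

  star? : ∀ x y → Dec (Star E x y)
  star? x y = map′ to from (via? n x y)

connected? : ∀ {n} (a : Vec ℕ n) → Dec (Connected a)
connected? a = Fin.all? (λ x → Fin.all? (λ y → Reachability.star? (edge? a) x y))

------------------------------------------------------------------------
-- Dyck paths

data Step : Set where
  U D : Step

δ : Step → ℤ
δ U = 1ℤ
δ D = -1ℤ

-- The y-coordinates of the lattice points of a path started at height y.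
heights : ∀ {l} → ℤ → Vec Step l → List ℤ
heights y []      = y ∷ []
heights y (s ∷ p) = y ∷ heights (y ℤ.+ δ s) p

endHeight : ∀ {l} → ℤ → Vec Step l → ℤ
endHeight y []      = y
endHeight y (s ∷ p) = endHeight (y ℤ.+ δ s) p

IsDyck : ∀ {l} → Vec Step l → Set
IsDyck p = All (0ℤ ℤ.≤_) (heights 0ℤ p) × endHeight 0ℤ p ≡ 0ℤ

height : ∀ {l} → Vec Step l → ℤ
height p = maxℤ 0ℤ (heights 0ℤ p)

isDyckOfHeight? : ∀ k {l} (p : Vec Step l) → Dec (IsDyck p × height p ≡ + k)
isDyckOfHeight? k p =
  (all? (0ℤ ℤ.≤?_) (heights 0ℤ p) ×-dec (endHeight 0ℤ p ℤ.≟ 0ℤ))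
  ×-dec (height p ℤ.≟ + k)

H : ℕ → ℕ → ℕ
H m k = length (filter (isDyckOfHeight? k) (words (U ∷ D ∷ []) (2 * m)))

------------------------------------------------------------------------
-- Polynomials in t over ℕ, given by their coefficients: f k is the
-- coefficient of t^k. Every polynomial below is a finite sum of monomials.

Poly : Set
Poly = ℕ → ℕ

_·t^_ : ℕ → ℕ → Poly
(c ·t^ i) k = if does (k ℕ.≟ i) then c else 0

0ₚ : Poly
0ₚ _ = 0

_+ₚ_ : Poly → Poly → Poly
(f +ₚ g) k = f k + g k

∑ : ∀ {A : Set} → List A → (A → Poly) → Poly
∑ xs f = foldr _+ₚ_ 0ₚ (map f xs)

[1⋯_] : ℕ → List ℕ
[1⋯ m ] = map suc (upTo m)

Pnest : ℕ → Poly
Pnest n = ∑ (DP n) (λ a → 1 ·t^ pnest a)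

Pnestᶜ : ℕ → Poly
Pnestᶜ n = ∑ (filter connected? (DP n)) (λ a → 1 ·t^ pnest a)

{-# OPTIONS --safe #-}

-- Put ℓⱼ = j − aⱼ, the leftmost neighbour of j (or j itself). The peak-cliques
-- are the intervals {i,…,j} with i = ℓⱼ and j last with this value, so reading
-- the vertices from left to right at most one clique opens and at most one
-- closes at each vertex. Encode vertex v by two steps: U or D according to
-- whether a clique opens at v or not, then D or U according to whether one
-- closes or not. The height between the vertices is twice the number of open
-- cliques, whence a Dyck path of semilength n, and a vertex lying in c cliques
-- contributes a largest height 2c − 1 or 2c; hence pnest = ⌈height/2⌉. Since
-- cliques close in the order in which they open, the area sequence is recovered
-- from the path by running a queue. The graph is connected iff the path has the
-- form U p D with p a Dyck path, and then ⌈height/2⌉ becomes ⌊height p/2⌋ + 1.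

module Submission where

open import Defs
open import Data.Nat.Base using (ℕ; _+_; _*_; _∸_; _≤_; ⌈_/2⌉)
open import Data.Product.Base using (_×_)
open import Relation.Binary.PropositionalEquality using (_≗_)

open import Data.Bool.Base using (if_then_else_; true; false)
open import Data.Empty using (⊥)
open import Data.Fin.Base as Fin using (Fin; zero; suc; toℕ; fromℕ<)
import Data.Fin.Properties as Fin
open import Data.Integer.Base as ℤ using (ℤ; +_; 0ℤ; +≤+)
import Data.Integer.Properties as ℤ
open import Data.List.Base as List
  using (List; []; _∷_; length; map; filter; upTo; allFin; cartesianProduct; tabulate)
import Data.List.Extrema as Extrema
open import Data.List.Extrema.Nat using () renaming (max to maxℕ)
open import Data.List.Extrema ℤ.≤-totalOrder using () renaming (max to maxℤ)
open import Data.List.Membership.Propositional using (_∈_; _∉_)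
open import Data.List.Membership.Propositional.Properties hiding (∈-lookup)
open import Data.List.Membership.Propositional.Properties.WithK using (unique∧set⇒bag)
open import Data.List.Properties
  using (length-map; length-++-comm; filter-reject; map-cong; map-tabulate)
open import Data.List.Relation.Binary.BagAndSetEquality using (∼bag⇒↭)
open import Data.List.Relation.Binary.Permutation.Propositional.Properties using (↭-length)
open import Data.List.Relation.Unary.All as All using (All; []; _∷_)
import Data.List.Relation.Unary.All.Properties as All
open import Data.List.Relation.Unary.AllPairs as AllPairs using (AllPairs; []; _∷_)
import Data.List.Relation.Unary.AllPairs.Properties as AllPairs
open import Data.List.Relation.Unary.Any using (here; there)
open import Data.List.Relation.Unary.Unique.Propositional using (Unique)
import Data.List.Relation.Unary.Unique.Propositional.Properties as Unique
open import Data.Nat.Base hiding (_+_; _*_; _∸_; _≤_; ℕ; ⌈_/2⌉)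
open import Data.Nat.Properties
open import Data.Product.Base using (_,_; proj₁; proj₂; ∃)
open import Data.Sum.Base as Sum using (_⊎_; inj₁; inj₂; [_,_]′)
open import Data.Unit.Base using (⊤; tt)
open import Data.Vec.Base using (Vec; []; _∷_; _∷ʳ_; lookup)
open import Data.Vec.Membership.DecPropositional _≟_ using () renaming (_∈?_ to _∈ᵥ?_)
open import Data.Vec.Membership.Propositional using () renaming (_∈_ to _∈ᵥ_; _∉_ to _∉ᵥ_)
open import Data.Vec.Membership.Propositional.Properties using (∈-lookup)
open import Data.Vec.Properties using (∷-injective; ∷-injectiveʳ; ∷ʳ-injectiveˡ)
open import Data.Vec.Relation.Unary.All as VecAll using ([]; _∷_)
import Data.Vec.Relation.Unary.All.Properties as VecAll
open import Data.Vec.Relation.Unary.Any as VecAny using () renaming (here to hereᵥ; there to thereᵥ)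
import Data.Vec.Relation.Unary.Any.Properties as VecAny
open import Function.Base using (_∘_; id)
open import Function.Bundles using (mk⇔)
open import Level using (0ℓ)
open import Relation.Binary.Bundles using (TotalOrder)
open import Relation.Binary.Construct.Closure.ReflexiveTransitive using (Star; ε; _◅_; reverse)
open import Relation.Binary.Definitions using (tri<; tri≈; tri>)
open import Relation.Binary.PropositionalEquality hiding (_≗_)
open import Relation.Nullary.Decidable
  using (Dec; does; yes; no; _×-dec_; dec-true; dec-false)
open import Relation.Nullary.Negation using (¬_; contradiction)
open import Relation.Unary using (Pred; Decidable)

-- Lists and polynomials

module _ {A B : Set} (f : A → B) where

  map-unique : ∀ {xs} → (∀ {x y} → x ∈ xs → y ∈ xs → f x ≡ f y → x ≡ y) →
               Unique xs → Unique (map f xs)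
  map-unique inj []         = []
  map-unique inj (x∉ ∷ xs!) =
    All.map⁺ (All.tabulate λ y∈ fx≡fy → All.lookup x∉ y∈ (inj (here refl) (there y∈) fx≡fy))
    ∷ map-unique (λ x∈ y∈ → inj (there x∈) (there y∈)) xs!

  -- Duplicate-free lists with the same members are permutations of each other. Injectivity is
  -- demanded on members only: a left end, for instance, determines a pair of vertices only among
  -- peak-edges.
  bijection⇒length≡ : ∀ {xs ys} → Unique xs → Unique ys →
    (∀ {x} → x ∈ xs → f x ∈ ys) →
    (∀ {x y} → x ∈ xs → y ∈ xs → f x ≡ f y → x ≡ y) →
    (∀ {y} → y ∈ ys → ∃ λ x → x ∈ xs × f x ≡ y) →
    length xs ≡ length ys
  bijection⇒length≡ {xs} {ys} xs! ys! into inj onto = trans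
    (sym (length-map f xs))
    (↭-length (∼bag⇒↭ (unique∧set⇒bag (map-unique inj xs!) ys! (mk⇔ to from))))
    where
    to : ∀ {y} → y ∈ map f xs → y ∈ ys
    to y∈ with x , x∈ , refl ← ∈-map⁻ f y∈ = into x∈
    from : ∀ {y} → y ∈ ys → y ∈ map f xs
    from y∈ with x , x∈ , refl ← onto y∈ = ∈-map⁺ f x∈

module _ {A : Set} {P Q R : Pred A 0ℓ}
         (P? : Decidable P) (Q? : Decidable Q) (R? : Decidable R) where

  length-filter-⊎ : (∀ {x} → P x → R x) → (∀ {x} → Q x → R x) →
    (∀ {x} → R x → P x ⊎ Q x) → (∀ {x} → P x → ¬ Q x) → ∀ xs →
    length (filter P? xs) + length (filter Q? xs) ≡ length (filter R? xs)
  length-filter-⊎ P⊆R Q⊆R R⊆ P∩Q []       = refl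
  length-filter-⊎ P⊆R Q⊆R R⊆ P∩Q (x ∷ xs) with P? x | Q? x | R? x
  ... | yes p | yes q | _      = contradiction q (P∩Q p)
  ... | yes p | no ¬q | yes r  = cong suc (length-filter-⊎ P⊆R Q⊆R R⊆ P∩Q xs)
  ... | no ¬p | yes q | yes r  =
    trans (+-suc _ _) (cong suc (length-filter-⊎ P⊆R Q⊆R R⊆ P∩Q xs))
  ... | no ¬p | no ¬q | yes r  = contradiction (R⊆ r) [ ¬p , ¬q ]′
  ... | yes p | _     | no ¬r  = contradiction (P⊆R p) ¬r
  ... | no ¬p | yes q | no ¬r  = contradiction (Q⊆R q) ¬r
  ... | no ¬p | no ¬q | no ¬r  = length-filter-⊎ P⊆R Q⊆R R⊆ P∩Q xs

filter-empty : ∀ {A : Set} {P : Pred A 0ℓ} (P? : Decidable P) {xs} →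
               (∀ {x} → x ∈ xs → ¬ P x) → length (filter P? xs) ≡ 0
filter-empty P? {[]}     ¬P = refl
filter-empty P? {x ∷ xs} ¬P =
  trans (cong length (filter-reject P? (¬P (here refl)))) (filter-empty P? (¬P ∘ there))

module _ {A : Set} {xs : List A} where

  words-unique : Unique xs → ∀ n → Unique (words xs n)
  words-unique xs! zero    = [] ∷ []
  words-unique xs! (suc n) =
    Unique.cartesianProductWith⁺ _∷_ ∷-injective xs! (words-unique xs! n)

  ∈-words⁺ : ∀ {n} {v : Vec A n} → VecAll.All (_∈ xs) v → v ∈ words xs n
  ∈-words⁺ []        = here refl
  ∈-words⁺ (x∈ ∷ v∈) = ∈-cartesianProductWith⁺ _∷_ x∈ (∈-words⁺ v∈)

∑-monomials : ∀ {A : Set} (g : A → ℕ) xs k →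
              ∑ xs (λ x → 1 ·t^ g x) k ≡ length (filter (λ x → k ≟ g x) xs)
∑-monomials g []       k = refl
-- `does (k ≟ g x)` computes to `k ≡ᵇ g x`, so one split evaluates both the monomial and the filter.
∑-monomials g (x ∷ xs) k with k ≡ᵇ g x
... | true  = cong suc (∑-monomials g xs k)
... | false = ∑-monomials g xs k

module _ (c : ℕ → ℕ) where

  ∑-coefficient-∉ : ∀ {xs k} → k ∉ xs → ∑ xs (λ i → c i ·t^ i) k ≡ 0
  ∑-coefficient-∉ {[]}         k∉ = refl
  ∑-coefficient-∉ {x ∷ xs} {k} k∉
    rewrite dec-false (k ≟ x) (k∉ ∘ here) = ∑-coefficient-∉ (k∉ ∘ there)

  ∑-coefficient-∈ : ∀ {xs k} → Unique xs → k ∈ xs → ∑ xs (λ i → c i ·t^ i) k ≡ c k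
  ∑-coefficient-∈ {k = k} (k∉ ∷ xs!) (here refl)
    rewrite dec-true (k ≟ k) refl =
      trans (cong (λ z → c k + z) (∑-coefficient-∉ (λ k∈ → All.lookup k∉ k∈ refl))) (+-identityʳ _)
  ∑-coefficient-∈ {x ∷ xs} {k} (x∉ ∷ xs!) (there k∈)
    rewrite dec-false (k ≟ x) (All.lookup x∉ k∈ ∘ sym) = ∑-coefficient-∈ xs! k∈

  -- The sum on the right is supported on 1, ..., m; hence the separate conditions at 0 and beyond
  -- `m`.
  ∑-coefficients : ∀ m (f : Poly) → (∀ k → 1 ≤ k → f k ≡ c k) →
    f 0 ≡ 0 → (∀ k → m < k → f k ≡ 0) → f ≗ ∑ [1⋯ m ] (λ i → c i ·t^ i)
  ∑-coefficients m f f≡c f0 f> zero = trans f0 (sym (∑-coefficient-∉ {[1⋯ m ]} 0∉))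
    where
    0∉ : 0 ∉ [1⋯ m ]
    0∉ 0∈ with _ , _ , () ← ∈-map⁻ suc 0∈
  ∑-coefficients m f f≡c f0 f> (suc k) with k <? m
  ... | yes k<m = trans (f≡c (suc k) (s≤s z≤n))
    (sym (∑-coefficient-∈ (Unique.map⁺ suc-injective (Unique.upTo⁺ m)) (∈-map⁺ suc (∈-upTo⁺ k<m))))
  ... | no  k≮m = trans (f> (suc k) (s≤s (≮⇒≥ k≮m))) (sym (∑-coefficient-∉ {[1⋯ m ]} k∉))
    where
    k∉ : suc k ∉ [1⋯ m ]
    k∉ k∈ with _ , i∈ , refl ← ∈-map⁻ suc k∈ = k≮m (∈-upTo⁻ i∈)

-- Dyck paths

module _ (O : TotalOrder 0ℓ 0ℓ 0ℓ) where
  open TotalOrder O using ()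
    renaming ( _≈_ to _≋_; _≤_ to _⊑_; refl to ⊑-refl
             ; trans to ⊑-trans; antisym to ⊑-antisym )
  open Extrema O

  -- Argues from the bounds that characterise a maximum, over any total order, so that it serves
  -- heights in ℤ and peak-nestings in ℕ alike.
  max-∷ : ∀ b xs {x z} → x ⊑ z → max b xs ⊑ z → z ⊑ x ⊎ z ⊑ max b xs → max b (x ∷ xs) ≋ z
  max-∷ b xs {x} {z} x⊑z m⊑z z⊑ = ⊑-antisym
    (max≤v⁺ (⊑-trans (v≤max⁺ b xs (inj₁ ⊑-refl)) m⊑z)
            (x⊑z ∷ All.map (λ ⊑m → ⊑-trans ⊑m m⊑z) (xs≤max b xs)))
    (case z⊑)
    where
    case : z ⊑ x ⊎ z ⊑ max b xs → z ⊑ max b (x ∷ xs)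
    case (inj₁ z⊑x) = v≤max⁺ b (x ∷ xs) (inj₂ (here z⊑x))
    case (inj₂ z⊑m) = ⊑-trans z⊑m
      (max≤v⁺ (v≤max⁺ b (x ∷ xs) (inj₁ ⊑-refl)) (All.tail (xs≤max b (x ∷ xs))))

-- Trades the integer heights of `IsDyck` for a natural number that later arguments can match on and
-- compare with the length of a queue.
Dyckℕ : ∀ {l} → ℕ → Vec Step l → Set
Dyckℕ h       []      = h ≡ 0
Dyckℕ h       (U ∷ p) = Dyckℕ (suc h) p
Dyckℕ zero    (D ∷ p) = ⊥
Dyckℕ (suc h) (D ∷ p) = Dyckℕ h p

dyckℕ? : ∀ {l} h (p : Vec Step l) → Dec (Dyckℕ h p)
dyckℕ? h       []      = h ≟ 0
dyckℕ? h       (U ∷ p) = dyckℕ? (suc h) p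
dyckℕ? zero    (D ∷ p) = no id
dyckℕ? (suc h) (D ∷ p) = dyckℕ? h p

-- Truncated subtraction makes this meaningless for paths going below the axis.
top : ∀ {l} → ℕ → Vec Step l → ℕ
top h []      = h
top h (U ∷ p) = h ⊔ top (suc h) p
top h (D ∷ p) = h ⊔ top (pred h) p

-- A down step from `+ suc h` computes to `+ h`, but an up step yields `+ (h + 1)` and needs this
-- rewriting.
up : ∀ h → + h ℤ.+ δ U ≡ + suc h
up h = cong +_ (+-comm h 1)

IsDyckFrom : ∀ {l} → ℤ → Vec Step l → Set
IsDyckFrom y p = All (0ℤ ℤ.≤_) (heights y p) × endHeight y p ≡ 0ℤ

start≥0 : ∀ {l y} {p : Vec Step l} → All (0ℤ ℤ.≤_) (heights y p) → 0ℤ ℤ.≤ y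
start≥0 {p = []}    (0≤y ∷ _) = 0≤y
start≥0 {p = _ ∷ _} (0≤y ∷ _) = 0≤y

toDyckℕ : ∀ {l} h (p : Vec Step l) → IsDyckFrom (+ h) p → Dyckℕ h p
toDyckℕ h       []      (_ , end)     = ℤ.+-injective end
toDyckℕ h       (U ∷ p) (_ ∷ ≥0 , end) =
  toDyckℕ (suc h) p (subst (λ y → IsDyckFrom y p) (up h) (≥0 , end))
toDyckℕ zero    (D ∷ p) (_ ∷ ≥0 , end) with () ← start≥0 {p = p} ≥0
toDyckℕ (suc h) (D ∷ p) (_ ∷ ≥0 , end) = toDyckℕ h p (≥0 , end)

fromDyckℕ : ∀ {l} h (p : Vec Step l) → Dyckℕ h p → IsDyckFrom (+ h) p
fromDyckℕ h       []      refl = (+≤+ z≤n ∷ []) , refl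
fromDyckℕ h       (U ∷ p) d
  with ≥0 , end ← subst (λ y → IsDyckFrom y p) (sym (up h)) (fromDyckℕ (suc h) p d)
  = +≤+ z≤n ∷ ≥0 , end
fromDyckℕ (suc h) (D ∷ p) d with ≥0 , end ← fromDyckℕ h p d = +≤+ z≤n ∷ ≥0 , end

maxℕ-∷ : ∀ x xs → maxℕ 0 (x ∷ xs) ≡ x ⊔ maxℕ 0 xs
maxℕ-∷ x xs = max-∷ ≤-totalOrder 0 xs (m≤m⊔n x _) (m≤n⊔m x _)
  ([ inj₁ ∘ ≤-reflexive , inj₂ ∘ ≤-reflexive ]′ (⊔-sel x _))

maxℤ-∷ : ∀ xs {x y} → maxℤ 0ℤ xs ≡ + y → maxℤ 0ℤ (+ x ∷ xs) ≡ + (x ⊔ y)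
maxℤ-∷ xs {x} {y} eq = max-∷ ℤ.≤-totalOrder 0ℤ xs (+≤+ (m≤m⊔n x y))
  (subst (ℤ._≤ + (x ⊔ y)) (sym eq) (+≤+ (m≤n⊔m x y)))
  ([ (λ e → inj₁ (ℤ.≤-reflexive (cong +_ e)))
   , (λ e → inj₂ (ℤ.≤-reflexive (trans (cong +_ e) (sym eq)))) ]′ (⊔-sel x y))

max-heights : ∀ {l} h (p : Vec Step l) → Dyckℕ h p → maxℤ 0ℤ (heights (+ h) p) ≡ + top h p
max-heights h       []      refl = refl
max-heights h       (U ∷ p) d    =
  maxℤ-∷ (heights _ p) (trans (cong (λ y → maxℤ 0ℤ (heights y p)) (up h)) (max-heights (suc h) p d))
max-heights (suc h) (D ∷ p) d    = maxℤ-∷ (heights _ p) (max-heights h p d)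

⌊n*2/2⌋≡n : ∀ n → ⌊ n * 2 /2⌋ ≡ n
⌊n*2/2⌋≡n zero    = refl
⌊n*2/2⌋≡n (suc n) = cong suc (⌊n*2/2⌋≡n n)

⌊1+n*2/2⌋≡n : ∀ n → ⌊ suc (n * 2) /2⌋ ≡ n
⌊1+n*2/2⌋≡n zero    = refl
⌊1+n*2/2⌋≡n (suc n) = cong suc (⌊1+n*2/2⌋≡n n)

⌊n/2⌋-inverse : ∀ i n → i ≡ ⌊ n /2⌋ → n ≡ i * 2 ⊎ n ≡ suc (i * 2)
⌊n/2⌋-inverse i       zero          refl = inj₁ refl
⌊n/2⌋-inverse i       (suc zero)    refl = inj₂ refl
⌊n/2⌋-inverse (suc i) (suc (suc n)) eq   =
  Sum.map (cong 2+) (cong 2+) (⌊n/2⌋-inverse i n (suc-injective eq))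

start≤length : ∀ {l} h (p : Vec Step l) → Dyckℕ h p → h ≤ l
start≤length h       []      refl = z≤n
start≤length h       (U ∷ p) d    = m≤n⇒m≤1+n (≤-trans (n≤1+n h) (start≤length (suc h) p d))
start≤length (suc h) (D ∷ p) d    = s≤s (start≤length h p d)

⊔-double-≤ : ∀ a b {c} → a + a ≤ c → b + b ≤ c → (a ⊔ b) + (a ⊔ b) ≤ c
⊔-double-≤ a b a≤ b≤ with ⊔-sel a b
... | inj₁ eq rewrite eq = a≤
... | inj₂ eq rewrite eq = b≤

-- Climbing from `h` to the top takes at least top - h steps, and coming down to 0 takes at least
-- top more.
top-double-≤ : ∀ {l} h (p : Vec Step l) → Dyckℕ h p → top h p + top h p ≤ h + l
top-double-≤         h       []      refl = z≤n
top-double-≤ {suc l} h       (U ∷ p) d    = ⊔-double-≤ h (top (suc h) p)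
  (+-monoʳ-≤ h (start≤length h (U ∷ p) d))
  (≤-trans (top-double-≤ (suc h) p d) (≤-reflexive (sym (+-suc h l))))
top-double-≤ {suc l} (suc h) (D ∷ p) d    = ⊔-double-≤ (suc h) (top h p)
  (+-monoʳ-≤ (suc h) (start≤length (suc h) (D ∷ p) d))
  (≤-trans (top-double-≤ h p d) (+-mono-≤ (n≤1+n h) (n≤1+n l)))

top≤semilength : ∀ n (p : Vec Step (n * 2)) → Dyckℕ 0 p → top 0 p ≤ n
top≤semilength n p d = ≤-trans (≤-reflexive (n≡⌊n+n/2⌋ _))
  (≤-trans (⌊n/2⌋-mono (top-double-≤ 0 p d)) (≤-reflexive (⌊n*2/2⌋≡n n)))

-- Counting Dyck paths by half their height

paths : ∀ l → List (Vec Step l)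
paths = words (U ∷ D ∷ [])

paths-unique : ∀ l → Unique (paths l)
paths-unique = words-unique (((λ ()) ∷ []) ∷ [] ∷ [])

∈-paths : ∀ {l} (p : Vec Step l) → p ∈ paths l
∈-paths p = ∈-words⁺ (VecAll.universal ∈-steps p)
  where
  ∈-steps : ∀ s → s ∈ U ∷ D ∷ []
  ∈-steps U = here refl
  ∈-steps D = there (here refl)

module _ (g : ℕ → ℕ) where

  DyckWith : ∀ {l} → ℕ → Vec Step l → Set
  DyckWith k p = Dyckℕ 0 p × k ≡ g (top 0 p)

  dyckWith? : ∀ {l} k (p : Vec Step l) → Dec (DyckWith k p)
  dyckWith? k p = dyckℕ? 0 p ×-dec (k ≟ g (top 0 p))

  -- The fibre of `g` over `k` is {j, j + 1}, which is why the numbers H occur in pairs of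
  -- consecutive heights. Rounding half the height up or down gives the pairs of the two
  -- polynomials.
  H-pair : ∀ m k j → k ≡ g j → k ≡ g (suc j) → (∀ h → k ≡ g h → h ≡ j ⊎ h ≡ suc j) →
           H m j + H m (suc j) ≡ length (filter (dyckWith? k) (paths (m * 2)))
  -- Lengths are written `m * 2` because `suc m * 2` computes to two further steps, the two that
  -- encode one vertex.
  H-pair m k j gj gj+1 only rewrite *-comm 2 m = length-filter-⊎
    (isDyckOfHeight? j) (isDyckOfHeight? (suc j)) (dyckWith? k)
    (λ {p} → of-height gj p) (λ {p} → of-height gj+1 p) (λ {p} → split p)
    (λ { (_ , h≡j) (_ , h≡1+j) → 1+n≢n (ℤ.+-injective (trans (sym h≡1+j) h≡j)) })
    (paths (m * 2))
    where
    of-height : ∀ {h} → k ≡ g h → ∀ {l} (p : Vec Step l) → IsDyck p × height p ≡ + h → DyckWith k p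
    of-height gh p (isDyck , height≡h) =
      d , trans gh (cong g (ℤ.+-injective (trans (sym height≡h) (max-heights 0 p d))))
      where
      d : Dyckℕ 0 p
      d = toDyckℕ 0 p isDyck
    split : ∀ {l} (p : Vec Step l) → DyckWith k p →
            (IsDyck p × height p ≡ + j) ⊎ (IsDyck p × height p ≡ + suc j)
    split p (d , k≡) with only (top 0 p) k≡
    ... | inj₁ eq = inj₁ (fromDyckℕ 0 p d , trans (max-heights 0 p d) (cong +_ eq))
    ... | inj₂ eq = inj₂ (fromDyckℕ 0 p d , trans (max-heights 0 p d) (cong +_ eq))

H-pair-⌈/2⌉ : ∀ m i → H m (2 * suc i ∸ 1) + H m (2 * suc i) ≡
              length (filter (dyckWith? ⌈_/2⌉ (suc i)) (paths (m * 2)))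
H-pair-⌈/2⌉ m i = trans
  (cong (λ j → H m (j ∸ 1) + H m j) (*-comm 2 (suc i)))
  (H-pair ⌈_/2⌉ m (suc i) (suc (i * 2))
    (cong suc (sym (⌊n*2/2⌋≡n i))) (cong suc (sym (⌊1+n*2/2⌋≡n i))) only)
  where
  only : ∀ h → suc i ≡ ⌈ h /2⌉ → h ≡ suc (i * 2) ⊎ h ≡ suc (suc (i * 2))
  only (suc h) eq = Sum.map (cong suc) (cong suc) (⌊n/2⌋-inverse i h (suc-injective eq))

H-pair-⌊/2⌋ : ∀ m i → H m (2 * suc i ∸ 2) + H m (2 * suc i ∸ 1) ≡
              length (filter (dyckWith? (suc ∘ ⌊_/2⌋) (suc i)) (paths (m * 2)))
H-pair-⌊/2⌋ m i = trans
  (cong (λ j → H m (j ∸ 2) + H m (j ∸ 1)) (*-comm 2 (suc i)))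
  (H-pair (suc ∘ ⌊_/2⌋) m (suc i) (i * 2)
    (cong suc (sym (⌊n*2/2⌋≡n i))) (cong suc (sym (⌊1+n*2/2⌋≡n i)))
    (λ h → ⌊n/2⌋-inverse i h ∘ suc-injective))

-- Area sequences as queues of open peak-cliques

private variable
  m n v b x : ℕ
  q t : List ℕ
  s c : Step
  l : Vec ℕ m

-- The area conditions after the substitution ℓᵢ = i - aᵢ, for the vertices from v on, numbered from
-- 0: ℓ is weakly increasing and ℓᵢ ≤ i. The bound `b` stands for the preceding value.
LeftEnds : ℕ → ℕ → Vec ℕ m → Set
LeftEnds v b []      = ⊤
LeftEnds v b (x ∷ l) = b ≤ x × x ≤ v × LeftEnds (suc v) x l

leftEnds-≥ : ∀ (l : Vec ℕ m) {z} → LeftEnds v b l → z ∈ᵥ l → b ≤ z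
leftEnds-≥ (x ∷ l) (b≤x , _)       (hereᵥ refl) = b≤x
leftEnds-≥ (x ∷ l) (b≤x , _ , ok) (thereᵥ z∈)  = ≤-trans b≤x (leftEnds-≥ l ok z∈)

-- A peak-clique starts at `z` iff `z` is a value of ℓ, and it lasts until the last occurrence of
-- `z`. Asking for v among the values from v on detects an opening; asking for ℓᵥ among the values
-- after v detects whether its clique stays open.
mark : ℕ → Vec ℕ m → Step
mark z l = if does (z ∈ᵥ? l) then U else D

-- Step 2v is U iff a peak-clique starts at v, step 2v + 1 is D iff one ends at v.
path : ℕ → Vec ℕ m → Vec Step (m * 2)
path v []      = []
path v (x ∷ l) = mark v (x ∷ l) ∷ mark x l ∷ path (suc v) l

push : Step → ℕ → List ℕ → List ℕ
push U v q = q List.∷ʳ v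
push D v q = q

pop : Step → List ℕ → List ℕ
pop U q       = q
pop D []      = []
pop D (x ∷ q) = q

front : List ℕ → ℕ
front []      = 0
front (x ∷ _) = x

-- Of two peak-cliques the one that starts first ends first, so the cliques
-- containing v form a queue, and the front of the queue starts at ℓᵥ.
leftEnds : ∀ m → ℕ → List ℕ → Vec Step (m * 2) → Vec ℕ m
leftEnds zero    v q []          = []
leftEnds (suc m) v q (s ∷ c ∷ p) =
  front (push s v q) ∷ leftEnds m (suc v) (pop c (push s v q)) p

-- Here `l` is the unread part of ℓ, and `q` lists its values below `v` in increasing order: the
-- left ends of the cliques already begun and not yet ended.
record Queue (v : ℕ) (q : List ℕ) {m} (l : Vec ℕ m) : Set where
  field
    sorted : AllPairs _<_ q
    sound  : ∀ {z} → z ∈ q → z ∈ᵥ l × z < v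
    found  : ∀ {z} → z ∈ᵥ l → z < v → z ∈ q

open Queue

sorted-∷ʳ : AllPairs _<_ q → All (_< v) q → AllPairs _<_ (q List.∷ʳ v)
sorted-∷ʳ q< q<v = AllPairs.++⁺ q< ([] ∷ []) (All.map (_∷ []) q<v)

queue-push : ∀ (l : Vec ℕ m) → Queue v q l → Queue (suc v) (push (mark v l) v q) l
queue-push {v = v} {q = q} l Q with v ∈ᵥ? l
... | yes v∈l = record
  { sorted = sorted-∷ʳ (Q .sorted) (All.tabulate (proj₂ ∘ Q .sound))
  ; sound  = sound′ ; found = found′ }
  where
  sound′ : ∀ {z} → z ∈ q List.∷ʳ v → z ∈ᵥ l × z < suc v
  sound′ z∈ with ∈-++⁻ q z∈
  ... | inj₁ z∈q with z∈l , z<v ← Q .sound z∈q = z∈l , m≤n⇒m≤1+n z<v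
  ... | inj₂ (here refl) = v∈l , ≤-refl
  found′ : ∀ {z} → z ∈ᵥ l → z < suc v → z ∈ q List.∷ʳ v
  found′ z∈l z<1+v with m<1+n⇒m<n∨m≡n z<1+v
  ... | inj₁ z<v  = ∈-++⁺ˡ (Q .found z∈l z<v)
  ... | inj₂ refl = ∈-++⁺ʳ q (here refl)
... | no v∉l = record
  { sorted = Q .sorted
  ; sound  = λ z∈q → proj₁ (Q .sound z∈q) , m≤n⇒m≤1+n (proj₂ (Q .sound z∈q))
  ; found  = found′ }
  where
  found′ : ∀ {z} → z ∈ᵥ l → z < suc v → z ∈ q
  found′ z∈l z<1+v with m<1+n⇒m<n∨m≡n z<1+v
  ... | inj₁ z<v  = Q .found z∈l z<v
  ... | inj₂ refl = contradiction z∈l v∉l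

-- The front of a sorted queue is a value still to come, and ℓᵥ is the least of those because ℓ
-- increases weakly; so nothing can stand before ℓᵥ.
queue-front : LeftEnds v b (x ∷ l) → Queue (suc v) q (x ∷ l) → ∃ λ t → q ≡ x ∷ t
queue-front {l = l} {q = q} (_ , x≤v , ok) Q =
  go q (Q .sorted) (Q .sound) (Q .found (hereᵥ refl) (s≤s x≤v))
  where
  go : ∀ q → AllPairs _<_ q → (∀ {z} → z ∈ q → z ∈ᵥ _ ∷ l × z < _) → _ ∈ q → ∃ λ t → q ≡ _ ∷ t
  go (h ∷ t) _ _ (here refl) = t , refl
  go (h ∷ t) (h< ∷ _) sound (there x∈t) with sound (here refl)
  ... | hereᵥ refl , _ = t , refl
  ... | thereᵥ h∈l , _ = contradiction (leftEnds-≥ l ok h∈l) (<⇒≱ (All.lookup h< x∈t))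

queue-pop : ∀ (l : Vec ℕ m) → Queue v (x ∷ t) (x ∷ l) → Queue v (pop (mark x l) (x ∷ t)) l
queue-pop {v = v} {x = x} {t = t} l Q with x ∈ᵥ? l
... | yes x∈l = record { sorted = Q .sorted ; sound = sound′ ; found = Q .found ∘ thereᵥ }
  where
  sound′ : ∀ {z} → z ∈ x ∷ t → z ∈ᵥ l × z < v
  sound′ z∈ with Q .sound z∈
  ... | hereᵥ refl , z<v = x∈l , z<v
  ... | thereᵥ z∈l , z<v = z∈l , z<v
... | no  x∉l = record { sorted = AllPairs.tail (Q .sorted) ; sound = sound′ ; found = found′ }
  where
  sound′ : ∀ {z} → z ∈ t → z ∈ᵥ l × z < v
  sound′ z∈ with Q .sound (there z∈)
  ... | hereᵥ refl , z<v = contradiction (All.lookup (AllPairs.head (Q .sorted)) z∈) (n≮n _)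
  ... | thereᵥ z∈l , z<v = z∈l , z<v
  found′ : ∀ {z} → z ∈ᵥ l → z < v → z ∈ t
  found′ z∈l z<v with Q .found (thereᵥ z∈l) z<v
  ... | here refl  = contradiction z∈l x∉l
  ... | there z∈t = z∈t

-- Between the push and the pop of vertex v the queue consists of exactly the cliques containing v.
-- Its invariant is returned too, for counting them.
queue-step : ∀ (l : Vec ℕ m) → LeftEnds v b (x ∷ l) → Queue v q (x ∷ l) → ∃ λ t →
  push (mark v (x ∷ l)) v q ≡ x ∷ t
  × Queue (suc v) (x ∷ t) (x ∷ l)
  × Queue (suc v) (pop (mark x l) (x ∷ t)) l
queue-step {v = v} {x = x} l ok Q with Q₁ ← queue-push (x ∷ l) Q with t , eq ← queue-front ok Q₁ =
  t , eq , Q₂ , queue-pop l Q₂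
  where
  Q₂ : Queue (suc v) (x ∷ t) (x ∷ l)
  Q₂ = subst (λ q → Queue (suc v) q (x ∷ l)) eq Q₁

queue-[] : Queue v q [] → q ≡ []
queue-[] {q = []}    Q = refl
queue-[] {q = x ∷ q} Q with () , _ ← Q .sound (here refl)

length-∷ʳ : ∀ (q : List ℕ) → q List.∷ʳ v ≡ x ∷ t → length q ≡ length t
length-∷ʳ {v = v} q eq = suc-injective (trans (length-++-comm (v ∷ []) q) (cong length eq))

-- Between vertices the height is twice the queue length: `U U` only pushes, `D D` only pops, and
-- the mixed pairs preserve the length. An equality of types can be used both for encoding and for
-- decoding.
dyck-step : ∀ s c q {l} (p : Vec Step l) → push s v q ≡ x ∷ t →
  Dyckℕ (length q * 2) (s ∷ c ∷ p) ≡ Dyckℕ (length (pop c (x ∷ t)) * 2) p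
dyck-step D D q p refl = refl
dyck-step D U q p refl = refl
dyck-step U D q p eq rewrite length-∷ʳ q eq = refl
dyck-step U U q p eq rewrite length-∷ʳ q eq = refl

⌈⌉-⊔ : ∀ i j → ⌈ i ⊔ j /2⌉ ≡ ⌈ i /2⌉ ⊔ ⌈ j /2⌉
⌈⌉-⊔ = mono-≤-distrib-⊔ ⌈n/2⌉-mono

-- At a vertex in c cliques the middle height is 2c - 1, reached upwards from 2c - 2 or downwards
-- from 2c. Rounding half of it up gives c, and this rounding is monotone, so it commutes with
-- maxima.
top-step : ∀ s c q {l} (p : Vec Step l) → push s v q ≡ x ∷ t →
  ⌈ top (length q * 2) (s ∷ c ∷ p) /2⌉ ≡
  length q ⊔ (length (x ∷ t) ⊔ ⌈ top (length (pop c (x ∷ t)) * 2) p /2⌉)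
top-step {x = x} {t = t} s c q p eq = begin
  ⌈ top (length q * 2) (s ∷ c ∷ p) /2⌉
    ≡⟨ cong ⌈_/2⌉ (first s eq) ⟩
  ⌈ length q * 2 ⊔ top (suc (length t * 2)) (c ∷ p) /2⌉
    ≡⟨ ⌈⌉-⊔ (length q * 2) _ ⟩
  ⌈ length q * 2 /2⌉ ⊔ ⌈ top (suc (length t * 2)) (c ∷ p) /2⌉
    -- `⌈ n /2⌉` is defined as `⌊ suc n /2⌋`, so the even height calls for the lemma on odd numbers.
    ≡⟨ cong₂ _⊔_ (⌊1+n*2/2⌋≡n (length q)) (cong ⌈_/2⌉ (second c)) ⟩
  length q ⊔ ⌈ suc (length t * 2) ⊔ rest /2⌉
    ≡⟨ cong (length q ⊔_) (⌈⌉-⊔ (suc (length t * 2)) rest) ⟩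
  length q ⊔ (⌈ suc (length t * 2) /2⌉ ⊔ ⌈ rest /2⌉)
    ≡⟨ cong (λ i → length q ⊔ (suc i ⊔ ⌈ rest /2⌉)) (⌊n*2/2⌋≡n (length t)) ⟩
  length q ⊔ (length (x ∷ t) ⊔ ⌈ rest /2⌉) ∎
  where
  open ≡-Reasoning
  rest : ℕ
  rest = top (length (pop c (x ∷ t)) * 2) p
  first : ∀ s → push s _ q ≡ x ∷ t →
          top (length q * 2) (s ∷ c ∷ p) ≡ length q * 2 ⊔ top (suc (length t * 2)) (c ∷ p)
  first U eq rewrite length-∷ʳ q eq = refl
  first D refl = refl
  second : ∀ c → top (suc (length t * 2)) (c ∷ p) ≡
                 suc (length t * 2) ⊔ top (length (pop c (x ∷ t)) * 2) p
  second U = refl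
  second D = refl

leftEnds-path : ∀ (l : Vec ℕ m) → LeftEnds v b l → Queue v q l → leftEnds m v q (path v l) ≡ l
leftEnds-path []      _  _ = refl
leftEnds-path (x ∷ l) ok@(_ , _ , ok′) Q with t , eq , _ , Q′ ← queue-step l ok Q
  rewrite eq = cong (x ∷_) (leftEnds-path l ok′ Q′)

path-dyck : ∀ (l : Vec ℕ m) → LeftEnds v b l → Queue v q l → Dyckℕ (length q * 2) (path v l)
path-dyck []      _  Q rewrite queue-[] Q = refl
path-dyck {v = v} {q = q} (x ∷ l) ok@(_ , _ , ok′) Q with t , eq , _ , Q′ ← queue-step l ok Q =
  subst id (sym (dyck-step (mark v (x ∷ l)) (mark x l) q (path (suc v) l) eq)) (path-dyck l ok′ Q′)

#open : ℕ → Vec ℕ m → ℕ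
#open v l = length (filter (_∈ᵥ? l) (upTo (suc v)))

nesting : ℕ → Vec ℕ m → ℕ
nesting v []      = 0
nesting v (x ∷ l) = #open v (x ∷ l) ⊔ nesting (suc v) l

queue-length : ∀ (l : Vec ℕ m) → Queue (suc v) q l → length q ≡ #open v l
queue-length {v = v} l Q = bijection⇒length≡ id
  (AllPairs.map <⇒≢ (Q .sorted)) (Unique.filter⁺ (_∈ᵥ? l) (Unique.upTo⁺ (suc v)))
  (λ z∈q → ∈-filter⁺ (_∈ᵥ? l) (∈-upTo⁺ (proj₂ (Q .sound z∈q))) (proj₁ (Q .sound z∈q)))
  (λ _ _ → id)
  (λ z∈ → let z∈upTo , z∈l = ∈-filter⁻ (_∈ᵥ? l) z∈ in
          _ , Q .found z∈l (∈-upTo⁻ z∈upTo) , refl)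

length-pop : ∀ c q → length (pop c q) ≤ length q
length-pop U q       = ≤-refl
length-pop D []      = ≤-refl
length-pop D (x ∷ q) = n≤1+n _

-- The queue left behind by a vertex is no longer than the queue at it, so only the queues at
-- vertices matter. The summand `length q` records the starting height and vanishes for the empty
-- initial queue.
path-top : ∀ (l : Vec ℕ m) → LeftEnds v b l → Queue v q l →
           ⌈ top (length q * 2) (path v l) /2⌉ ≡ length q ⊔ nesting v l
path-top []      _  Q rewrite queue-[] Q = refl
path-top {v = v} {q = q} (x ∷ l) ok@(_ , _ , ok′) Q
  with t , eq , Q₁ , Q′ ← queue-step l ok Q = begin
  ⌈ top (length q * 2) (path v (x ∷ l)) /2⌉
    ≡⟨ top-step (mark v (x ∷ l)) (mark x l) q (path (suc v) l) eq ⟩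
  length q ⊔ (length (x ∷ t) ⊔ ⌈ top (length q′ * 2) (path (suc v) l) /2⌉)
    ≡⟨ cong (λ i → length q ⊔ (length (x ∷ t) ⊔ i)) (path-top l ok′ Q′) ⟩
  length q ⊔ (length (x ∷ t) ⊔ (length q′ ⊔ nesting (suc v) l))
    ≡⟨ cong (length q ⊔_) (sym (⊔-assoc (length (x ∷ t)) (length q′) _)) ⟩
  length q ⊔ ((length (x ∷ t) ⊔ length q′) ⊔ nesting (suc v) l)
    ≡⟨ cong (λ i → length q ⊔ (i ⊔ nesting (suc v) l))
            (m≥n⇒m⊔n≡m (length-pop (mark x l) (x ∷ t))) ⟩
  length q ⊔ (length (x ∷ t) ⊔ nesting (suc v) l)
    ≡⟨ cong (λ i → length q ⊔ (i ⊔ nesting (suc v) l)) (queue-length (x ∷ l) Q₁) ⟩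
  length q ⊔ nesting v (x ∷ l) ∎
  where
  open ≡-Reasoning
  q′ : List ℕ
  q′ = pop (mark x l) (x ∷ t)

-- Paths meeting the axis only at their end, and linked vertices

Prime : ∀ {l} → ℕ → Vec Step l → Set
Prime h       []      = h ≡ 0
Prime zero    (_ ∷ p) = ⊥
Prime (suc h) (U ∷ p) = Prime (suc (suc h)) p
Prime (suc h) (D ∷ p) = Prime h p

-- The height in the middle of a vertex is odd, hence never 0; `0 < length q` keeps the start off
-- the axis.
prime-step : ∀ s c q {l} (p : Vec Step l) → 0 < length q → push s v q ≡ x ∷ t →
  Prime (length q * 2) (s ∷ c ∷ p) ≡ Prime (length (pop c (x ∷ t)) * 2) p
prime-step D D q p _ refl = refl
prime-step D U q p _ refl = refl
prime-step U D q@(_ ∷ _) p _ eq rewrite sym (length-∷ʳ q eq) = refl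
prime-step U U q@(_ ∷ _) p _ eq rewrite sym (length-∷ʳ q eq) = refl

-- ℓᵥ < v means that v is adjacent to v - 1, in other words that some clique spans the gap before v.
Linked : ℕ → Vec ℕ m → Set
Linked v []      = ⊤
Linked v (x ∷ l) = x < v × Linked (suc v) l

-- An entry of the queue is below v and is a value still to come, and ℓᵥ is the least such value.
queue-nonempty : LeftEnds v b (x ∷ l) → Queue v q (x ∷ l) → 0 < length q → x < v
queue-nonempty {l = l} {q = _ ∷ _} (_ , _ , ok) Q _ with Q .sound (here refl)
... | hereᵥ refl , x<v = x<v
... | thereᵥ z∈l , z<v = ≤-<-trans (leftEnds-≥ l ok z∈l) z<v

0<length : ∀ {z} → z ∈ q → 0 < length q
0<length {_ ∷ _} _ = s≤s z≤n

path-prime⁺ : ∀ (l : Vec ℕ m) → LeftEnds v b l → Queue v q l →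
              Linked v l → Prime (length q * 2) (path v l)
path-prime⁺ []      _ Q _ rewrite queue-[] Q = refl
path-prime⁺ {v = v} {q = q} (x ∷ l) ok@(_ , _ , ok′) Q (x<v , lk)
  with t , eq , _ , Q′ ← queue-step l ok Q =
  subst id (sym (prime-step (mark v (x ∷ l)) (mark x l) q (path (suc v) l) 0<∣q∣ eq))
    (path-prime⁺ l ok′ Q′ lk)
  where
  0<∣q∣ : 0 < length q
  0<∣q∣ = 0<length (Q .found (hereᵥ refl) x<v)

path-prime⁻ : ∀ (l : Vec ℕ m) → LeftEnds v b l → Queue v q l →
              Prime (length q * 2) (path v l) → Linked v l
path-prime⁻ []      _ Q _ = tt
-- An empty queue with a vertex left means height 0 with steps left, which `Prime` forbids.
path-prime⁻ {v = v} {q = q@(_ ∷ _)} (x ∷ l) ok@(_ , _ , ok′) Q pr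
  with t , eq , _ , Q′ ← queue-step l ok Q =
  queue-nonempty ok Q (s≤s z≤n) ,
  path-prime⁻ l ok′ Q′
    (subst id (prime-step (mark v (x ∷ l)) (mark x l) q (path (suc v) l) (s≤s z≤n) eq) pr)

-- Decoding a Dyck path

pop-⊆ : ∀ c {q z} → z ∈ pop c q → z ∈ q
pop-⊆ U         z∈ = z∈
pop-⊆ D {_ ∷ _} z∈ = there z∈

pop-sorted : ∀ c → AllPairs _<_ q → AllPairs _<_ (pop c q)
pop-sorted U q<                 = q<
pop-sorted D []                 = []
pop-sorted D (_ ∷ q<)           = q<

push-sorted : ∀ s → AllPairs _<_ q → All (_< v) q → AllPairs _<_ (push s v q)
push-sorted U q< q<v = sorted-∷ʳ q< q<v
push-sorted D q< q<v = q<

push-All : ∀ {P : ℕ → Set} s → All P q → P v → All P (push s v q)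
push-All U Pq Pv = All.∷ʳ⁺ Pq Pv
push-All D Pq Pv = Pq

-- With an empty queue the height is 0, so a Dyck path must go up. The default value in `front` is
-- therefore never read.
dyck-push : ∀ s {l} {p : Vec Step l} q → Dyckℕ (length q * 2) (s ∷ p) →
            ∃ λ x → ∃ λ t → push s v q ≡ x ∷ t
dyck-push U []      _ = _ , _ , refl
dyck-push U (x ∷ q) _ = _ , _ , refl
dyck-push D (x ∷ q) _ = _ , _ , refl

record Decoded (v b : ℕ) (q : List ℕ) {m} (p : Vec Step (m * 2)) (l : Vec ℕ m) : Set where
  field
    leftEnds! : LeftEnds v b l
    queue!    : Queue v q l
    path!     : path v l ≡ p

open Decoded

mark-∈ : ∀ z (l : Vec ℕ m) → z ∈ᵥ l → mark z l ≡ U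
mark-∈ z l z∈ rewrite dec-true (z ∈ᵥ? l) z∈ = refl

mark-∉ : ∀ z (l : Vec ℕ m) → z ∉ᵥ l → mark z l ≡ D
mark-∉ z l z∉ rewrite dec-false (z ∈ᵥ? l) z∉ = refl

-- Decoding runs forwards but is verified backwards: the invariant for the rest yields the one
-- before the step and forces the mark. If x was popped, the rest of the queue lies above x, so x
-- cannot recur.
queue-unpop : ∀ c → AllPairs _<_ (x ∷ t) → All (_< v) (x ∷ t) →
              Queue v (pop c (x ∷ t)) l → Queue v (x ∷ t) (x ∷ l) × mark x l ≡ c
queue-unpop {x = x} {t = t} {v = v} {l = l} U x∷t< x∷t<v Q =
  record { sorted = x∷t<
         ; sound = λ z∈ → thereᵥ (proj₁ (Q .sound z∈)) , proj₂ (Q .sound z∈)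
         ; found = found′ } ,
  mark-∈ x l (proj₁ (Q .sound (here refl)))
  where
  found′ : ∀ {z} → z ∈ᵥ x ∷ l → z < v → z ∈ x ∷ t
  found′ (hereᵥ refl) _   = here refl
  found′ (thereᵥ z∈)  z<v = Q .found z∈ z<v
queue-unpop {x = x} {t = t} {v = v} {l = l} D x∷t<@(x< ∷ _) x∷t<v@(x<v ∷ _) Q =
  record { sorted = x∷t< ; sound = sound′ ; found = found′ } ,
  mark-∉ x l (λ x∈l → n≮n x (All.lookup x< (Q .found x∈l x<v)))
  where
  sound′ : ∀ {z} → z ∈ x ∷ t → z ∈ᵥ x ∷ l × z < v
  sound′ (here refl) = hereᵥ refl , x<v
  sound′ (there z∈)  = thereᵥ (proj₁ (Q .sound z∈)) , proj₂ (Q .sound z∈)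
  found′ : ∀ {z} → z ∈ᵥ x ∷ l → z < v → z ∈ x ∷ t
  found′ (hereᵥ refl) _   = here refl
  found′ (thereᵥ z∈)  z<v = there (Q .found z∈ z<v)

queue-unpush : ∀ s (l : Vec ℕ m) → AllPairs _<_ q → All (_< v) q →
               Queue (suc v) (push s v q) l → Queue v q l × mark v l ≡ s
queue-unpush {q = q} {v = v} U l q< q<v Q =
  record { sorted = q<
         ; sound = λ z∈ → proj₁ (Q .sound (∈-++⁺ˡ z∈)) , All.lookup q<v z∈
         ; found = found′ } ,
  mark-∈ v l (proj₁ (Q .sound (∈-++⁺ʳ q (here refl))))
  where
  found′ : ∀ {z} → z ∈ᵥ l → z < v → z ∈ q
  found′ z∈ z<v with ∈-++⁻ q (Q .found z∈ (m≤n⇒m≤1+n z<v))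
  ... | inj₁ z∈q = z∈q
  ... | inj₂ (here refl) = contradiction z<v (n≮n _)
queue-unpush {q = q} {v = v} D l q< q<v Q =
  record { sorted = q<
         ; sound = λ z∈ → proj₁ (Q .sound z∈) , All.lookup q<v z∈
         ; found = λ z∈ z<v → Q .found z∈ (m≤n⇒m≤1+n z<v) } ,
  mark-∉ v l (λ v∈ → n≮n v (All.lookup q<v (Q .found v∈ ≤-refl)))

decode : ∀ m {v b q} (p : Vec Step (m * 2)) →
         AllPairs _<_ q → All (_< v) q → All (b ≤_) q → b ≤ v →
         Dyckℕ (length q * 2) p → Decoded v b q p (leftEnds m v q p)
decode zero {q = []} [] q< q<v b≤q b≤v d = record
  { leftEnds! = tt ; queue! = record { sorted = [] ; sound = λ () ; found = λ () } ; path! = refl }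
decode (suc m) {v} {b} {q} (s ∷ c ∷ p) q< q<v b≤q b≤v d
  with x , t , eq ← dyck-push {v = v} s q d
  with q₁< ← push-sorted {v = v} s q< q<v
     | q₁<1+v ← push-All s (All.map m≤n⇒m≤1+n q<v) (n<1+n v)
     | b≤q₁ ← push-All s b≤q b≤v
     -- Instantiated before `rewrite eq`, so that `push s v q` becomes `x ∷ t` in its type as well.
     | unpush ← (λ (l : Vec ℕ (suc m)) → queue-unpush s l q< q<v)
  rewrite eq
  with x< ∷ _ ← q₁< | x<1+v ∷ _ ← q₁<1+v | b≤x ∷ _ ← b≤q₁
  with rest ← decode m {suc v} {x} p (pop-sorted c q₁<)
                (All.tabulate (All.lookup q₁<1+v ∘ pop-⊆ c))
                -- What remains in the sorted queue is at least x, so x, the value just emitted, is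
                -- the new lower bound.
                (All.tabulate (All.lookup (≤-refl ∷ All.map <⇒≤ x<) ∘ pop-⊆ c))
                (<⇒≤ x<1+v) (subst id (dyck-step s c q p eq) d)
  with Q₁ , c≡ ← queue-unpop c q₁< q₁<1+v (rest .queue!)
  with Q , s≡ ← unpush _ Q₁ = record
  { leftEnds! = b≤x , ≤-pred x<1+v , rest .leftEnds!
  ; queue!    = Q
  ; path!     = cong₂ _∷_ s≡ (cong₂ _∷_ c≡ (rest .path!)) }

-- The graph of an area sequence

-- Exchanges an area sequence (aᵢ) with the sequence of leftmost neighbours i − aᵢ.
reflect : ℕ → Vec ℕ m → Vec ℕ m
reflect v []      = []
reflect v (x ∷ a) = v ∸ x ∷ reflect (suc v) a

lookup-reflect : ∀ v (a : Vec ℕ m) i → lookup (reflect v a) i ≡ (v + toℕ i) ∸ lookup a i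
lookup-reflect v (x ∷ a) zero    = cong (_∸ x) (sym (+-identityʳ v))
lookup-reflect v (x ∷ a) (suc i) =
  trans (lookup-reflect (suc v) a i) (cong (_∸ lookup a i) (sym (+-suc v (toℕ i))))

reflect-involutive : ∀ (a : Vec ℕ m) → (∀ i → lookup a i ≤ v + toℕ i) → reflect v (reflect v a) ≡ a
reflect-involutive         []      a≤ = refl
reflect-involutive {v = v} (x ∷ a) a≤ = cong₂ _∷_
  (m∸[m∸n]≡n (subst (x ≤_) (+-identityʳ v) (a≤ zero)))
  (reflect-involutive a (λ i → subst (lookup a i ≤_) (+-suc v (toℕ i)) (a≤ (suc i))))

leftEnds-≤ : ∀ (l : Vec ℕ m) → LeftEnds v b l → ∀ i → lookup l i ≤ v + toℕ i
leftEnds-≤ {v = v} (x ∷ l) (_ , x≤v , _) zero    = ≤-trans x≤v (m≤m+n v 0)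
leftEnds-≤ {v = v} (x ∷ l) (_ , _ , ok) (suc i) =
  subst (lookup l i ≤_) (sym (+-suc v (toℕ i))) (leftEnds-≤ l ok i)

leftEnds-mono : ∀ (l : Vec ℕ m) → LeftEnds v b l → ∀ {i j} → i Fin.≤ j → lookup l i ≤ lookup l j
leftEnds-mono (x ∷ l) (_ , _ , ok) {zero}  {zero}  _         = ≤-refl
leftEnds-mono (x ∷ l) (_ , _ , ok) {zero}  {suc j} _         = leftEnds-≥ l ok (∈-lookup j l)
leftEnds-mono (x ∷ l) (_ , _ , ok) {suc i} {suc j} (s≤s i≤j) = leftEnds-mono l ok i≤j

reflect-leftEnds : ∀ (a : Vec ℕ m) → (∀ i → lookup a i ≤ v + toℕ i) →
  (∀ h i → toℕ i ≡ suc (toℕ h) → lookup a i ≤ suc (lookup a h)) →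
  (∀ i → toℕ i ≡ 0 → b ≤ v ∸ lookup a i) → LeftEnds v b (reflect v a)
reflect-leftEnds         []      a≤ step b≤ = tt
reflect-leftEnds {v = v} (x ∷ a) a≤ step b≤ = b≤ zero refl , m∸n≤m v x ,
  reflect-leftEnds a
    (λ i → subst (lookup a i ≤_) (+-suc v (toℕ i)) (a≤ (suc i)))
    (λ h i eq → step (suc h) (suc i) (cong suc eq))
    -- `suc v ∸ suc x` computes to `v ∸ x`: an area sequence growing by at most 1 is an ℓ that does
    -- not decrease.
    (λ i eq → ∸-monoʳ-≤ (suc v) (step zero (suc i) (cong suc eq)))

area-≤ : ∀ (a : Vec ℕ n) → IsAreaSequence a → ∀ i → lookup a i ≤ toℕ i
area-≤ a (a< , _) i = ≤-pred (a< i)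

area⇒leftEnds : ∀ (a : Vec ℕ n) → IsAreaSequence a → LeftEnds 0 0 (reflect 0 a)
area⇒leftEnds a ia@(_ , step) = reflect-leftEnds a (area-≤ a ia)
  (λ h i eq → ≤-trans (step h i (cong suc eq)) (≤-reflexive (+-comm _ 1))) (λ _ _ → z≤n)

leftEnds⇒area : ∀ (l : Vec ℕ n) → LeftEnds 0 0 l → IsAreaSequence (reflect 0 l)
leftEnds⇒area l ok =
  (λ i → s≤s (≤-trans (≤-reflexive (lookup-reflect 0 l i)) (m∸n≤m (toℕ i) (lookup l i)))) , step
  where
  open ≤-Reasoning
  step : ∀ h i → label i ≡ suc (label h) → lookup (reflect 0 l) i ≤ lookup (reflect 0 l) h + 1
  step h i eq = begin
    lookup (reflect 0 l) i       ≡⟨ lookup-reflect 0 l i ⟩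
    toℕ i ∸ lookup l i           ≤⟨ ∸-monoʳ-≤ (toℕ i) (leftEnds-mono l ok {h} {i} h≤i) ⟩
    toℕ i ∸ lookup l h           ≡⟨ cong (_∸ lookup l h) i≡1+h ⟩
    suc (toℕ h) ∸ lookup l h     ≡⟨ +-∸-assoc 1 (leftEnds-≤ l ok h) ⟩
    suc (toℕ h ∸ lookup l h)     ≡⟨ cong suc (lookup-reflect 0 l h) ⟨
    suc (lookup (reflect 0 l) h) ≡⟨ +-comm 1 _ ⟩
    lookup (reflect 0 l) h + 1   ∎
    where
    i≡1+h : toℕ i ≡ suc (toℕ h)
    i≡1+h = suc-injective eq
    h≤i : toℕ h ≤ toℕ i
    h≤i = ≤-trans (n≤1+n _) (≤-reflexive (sym i≡1+h))

opens : ℕ → Vec ℕ m → Fin m → List ℕ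
opens v (x ∷ l) zero    = filter (_∈ᵥ? (x ∷ l)) (upTo (suc v))
opens v (x ∷ l) (suc i) = opens (suc v) l i

opens-unique : ∀ (l : Vec ℕ m) i → Unique (opens v l i)
opens-unique (x ∷ l) zero    = Unique.filter⁺ (_∈ᵥ? (x ∷ l)) (Unique.upTo⁺ _)
opens-unique (x ∷ l) (suc i) = opens-unique l i

∈-opens⁺ : ∀ (l : Vec ℕ m) {i j} → i Fin.≤ j → lookup l j ≤ v + toℕ i → lookup l j ∈ opens v l i
∈-opens⁺ {v = v} (x ∷ l) {zero} {j} _ l≤ = ∈-filter⁺ (_∈ᵥ? (x ∷ l))
  (∈-upTo⁺ (s≤s (≤-trans l≤ (≤-reflexive (+-identityʳ v))))) (∈-lookup j (x ∷ l))
∈-opens⁺ {v = v} (x ∷ l) {suc i} {suc j} (s≤s i≤j) l≤ =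
  ∈-opens⁺ l i≤j (≤-trans l≤ (≤-reflexive (+-suc v (toℕ i))))

∈-opens⁻ : ∀ (l : Vec ℕ m) i {z} → z ∈ opens v l i →
           z ≤ v + toℕ i × ∃ λ j → i Fin.≤ j × lookup l j ≡ z
∈-opens⁻ {v = v} (x ∷ l) zero z∈
  with z∈upTo , z∈l ← ∈-filter⁻ (_∈ᵥ? (x ∷ l)) {xs = upTo (suc v)} z∈ =
  ≤-trans (≤-pred (∈-upTo⁻ z∈upTo)) (m≤m+n v 0) ,
  VecAny.index z∈l , z≤n , sym (VecAny.lookup-index z∈l)
∈-opens⁻ {v = v} (x ∷ l) (suc i) {z} z∈ with z≤ , j , i≤j , eq ← ∈-opens⁻ l i z∈ =
  subst (z ≤_) (sym (+-suc v (toℕ i))) z≤ , suc j , s≤s i≤j , eq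

nesting-max : ∀ v (l : Vec ℕ m) → maxℕ 0 (tabulate (length ∘ opens v l)) ≡ nesting v l
nesting-max v []      = refl
nesting-max v (x ∷ l) = trans (maxℕ-∷ _ (tabulate (length ∘ opens (suc v) l)))
  (cong (#open v (x ∷ l) ⊔_) (nesting-max (suc v) l))

-- Supplies the right end of the clique whose left end is a given value of ℓ.
lastOccurrence : ∀ (l : Vec ℕ m) j → ∃ λ j′ → j Fin.≤ j′ × lookup l j′ ≡ lookup l j ×
                 (∀ k → j′ Fin.< k → lookup l k ≢ lookup l j)
lastOccurrence (x ∷ l) zero with x ∈ᵥ? l
... | no  x∉l = zero , z≤n , refl , λ { (suc k) _ eq → x∉l (subst (_∈ᵥ l) eq (∈-lookup k l)) }
... | yes x∈l with j′ , _ , eq , last ← lastOccurrence l (VecAny.index x∈l)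
  rewrite sym (VecAny.lookup-index x∈l) =
  suc j′ , z≤n , eq , λ { (suc k) (s≤s j′<k) → last k j′<k }
lastOccurrence (x ∷ l) (suc j) with j′ , j≤j′ , eq , last ← lastOccurrence l j =
  suc j′ , s≤s j≤j′ , eq , λ { (suc k) (s≤s j′<k) → last k j′<k }

vertex : x < n → ∃ λ (i : Fin n) → toℕ i ≡ x
vertex x<n = fromℕ< x<n , Fin.toℕ-fromℕ< x<n

module _ (a : Vec ℕ n) (ia : IsAreaSequence a) where

  left : Fin n → ℕ
  left = lookup (reflect 0 a)

  left≡ : ∀ i → left i ≡ toℕ i ∸ lookup a i
  left≡ = lookup-reflect 0 a

  left-≤ : ∀ i → left i ≤ toℕ i
  left-≤ = leftEnds-≤ (reflect 0 a) (area⇒leftEnds a ia)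

  left-mono : ∀ {i j} → i Fin.≤ j → left i ≤ left j
  left-mono = leftEnds-mono (reflect 0 a) (area⇒leftEnds a ia)

  label-∸ : ∀ i → label i ∸ lookup a i ≡ suc (left i)
  label-∸ i = trans (+-∸-assoc 1 (area-≤ a ia i)) (cong suc (sym (left≡ i)))

  edge⁺ : ∀ {j i} → j Fin.< i → left i ≤ toℕ j → Edge< a j i
  edge⁺ {i = i} j<i l≤j = j<i , ≤-trans (≤-reflexive (label-∸ i)) (s≤s l≤j)

  edge⁻ : ∀ {j i} → Edge< a j i → left i ≤ toℕ j
  edge⁻ {i = i} (_ , le) = ≤-pred (≤-trans (≤-reflexive (sym (label-∸ i))) le)

  -- Treats both kinds of peak-edge at once: an isolated vertex is the case i = j.
  Peak : Fin n → Fin n → Set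
  Peak i j = left j ≡ toℕ i × (∀ k → j Fin.< k → toℕ i < left k)

  peakEdge⇒peak : ∀ {i j} → PeakEdge a i j → Peak i j
  peakEdge⇒peak {i} (inj₁ (refl , isolated)) = ≤∧≮⇒≡ (left-≤ i) left≮i , after
    where
    left≮i : ¬ left i < toℕ i
    left≮i left<i with y , y≡ ← vertex (<-trans left<i (Fin.toℕ<n i)) =
      isolated y (inj₂ (edge⁺ (subst (_< toℕ i) (sym y≡) left<i) (≤-reflexive (sym y≡))))
    after : ∀ k → i Fin.< k → toℕ i < left k
    after k i<k = ≰⇒> (λ l≤i → isolated k (inj₁ (edge⁺ i<k l≤i)))
  peakEdge⇒peak {i} {j} (inj₂ (i<j , inj₂ (j<i , _) , _)) = contradiction j<i (<-asym i<j)
  peakEdge⇒peak {i} {j} (inj₂ (i<j , inj₁ e , no-right , no-left)) =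
    ≤∧≮⇒≡ (edge⁻ e) left≮i , after
    where
    left≮i : ¬ left j < toℕ i
    -- `k` is the vertex i - 1; ℓⱼ < i would make {i - 1, j} an edge.
    left≮i left<i with k , k≡ ← vertex (≤-<-trans (pred[n]≤n {toℕ i}) (Fin.toℕ<n i)) =
      no-left k (cong suc 1+k≡i)
        (inj₁ (edge⁺ k<j (≤-pred (≤-trans left<i (≤-reflexive (sym 1+k≡i))))))
      where
      1+k≡i : suc (toℕ k) ≡ toℕ i
      1+k≡i = trans (cong suc k≡) (suc-pred (toℕ i) {{>-nonZero (≤-<-trans z≤n left<i)}})
      k<j : k Fin.< j
      k<j = <-trans (≤-reflexive 1+k≡i) i<j
    after : ∀ k → j Fin.< k → toℕ i < left k
    -- `k₀` is the vertex j + 1, which is not adjacent to i; monotonicity of ℓ passes this on to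
    -- every later `k`.
    after k j<k with k₀ , k₀≡ ← vertex (≤-<-trans j<k (Fin.toℕ<n k)) =
      ≤-trans (≰⇒> (λ l≤i → no-right k₀ (cong suc k₀≡) (inj₁ (edge⁺ i<k₀ l≤i))))
              (left-mono {k₀} {k} (≤-trans (≤-reflexive k₀≡) j<k))
      where
      i<k₀ : i Fin.< k₀
      i<k₀ = <-trans i<j (≤-reflexive (sym k₀≡))

  peak⇒peakEdge : ∀ {i j} → Peak i j → PeakEdge a i j
  peak⇒peakEdge {i} {j} (left≡i , after)
    with m≤n⇒m<n∨m≡n (≤-trans (≤-reflexive (sym left≡i)) (left-≤ j))
  ... | inj₂ i≡j with refl ← Fin.toℕ-injective i≡j = inj₁ (refl , isolated)
    where
    isolated : Isolated a i
    isolated y (inj₁ e@(i<y , _)) = <⇒≱ (after y i<y) (edge⁻ e)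
    isolated y (inj₂ e@(y<i , _)) = <⇒≱ y<i (≤-trans (≤-reflexive (sym left≡i)) (edge⁻ e))
  ... | inj₁ i<j = inj₂ (i<j , inj₁ (edge⁺ i<j (≤-reflexive left≡i)) , no-right , no-left)
    where
    no-right : ∀ k → label k ≡ suc (label j) → ¬ Edge a i k
    no-right k eq (inj₁ e) = <⇒≱ (after k (≤-reflexive (sym (suc-injective eq)))) (edge⁻ e)
    no-right k eq (inj₂ (k<i , _)) =
      <-asym k<i (<-trans i<j (≤-reflexive (sym (suc-injective eq))))
    no-left : ∀ k → suc (label k) ≡ label i → ¬ Edge a k j
    no-left k eq (inj₁ e) =
      <⇒≱ (≤-reflexive (suc-injective eq)) (≤-trans (≤-reflexive (sym left≡i)) (edge⁻ e))
    no-left k eq (inj₂ (j<k , _)) = <-asym j<k (<-trans (≤-reflexive (suc-injective eq)) i<j)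

  -- Cliques are matched with their left ends. The left end of a clique containing v is at most v
  -- and is a value of ℓ at or after v; conversely such a value fixes the clique, which ends at its
  -- last occurrence.
  peakNesting≡ : ∀ v → peakNesting a v ≡ length (opens 0 (reflect 0 a) v)
  peakNesting≡ v = bijection⇒length≡ (toℕ ∘ proj₁)
    (Unique.filter⁺ (inPeakClique? a v)
      (Unique.cartesianProduct⁺ (Unique.allFin⁺ n) (Unique.allFin⁺ n)))
    (opens-unique (reflect 0 a) v) into inj onto
    where
    cliques : List (Fin n × Fin n)
    cliques = filter (inPeakClique? a v) (cartesianProduct (allFin n) (allFin n))
    member : ∀ {ij} → ij ∈ cliques → InPeakClique a v ij
    member = proj₂ ∘ ∈-filter⁻ (inPeakClique? a v) {xs = cartesianProduct (allFin n) (allFin n)}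
    into : ∀ {ij} → ij ∈ cliques → toℕ (proj₁ ij) ∈ opens 0 (reflect 0 a) v
    into {i , j} ij∈
      with pe , i≤v , v≤j ← member ij∈
      with left≡i , _ ← peakEdge⇒peak pe =
      subst (_∈ opens 0 (reflect 0 a) v) left≡i
        (∈-opens⁺ (reflect 0 a) v≤j (≤-trans (≤-reflexive left≡i) i≤v))
    inj : ∀ {ij ij′} → ij ∈ cliques → ij′ ∈ cliques → toℕ (proj₁ ij) ≡ toℕ (proj₁ ij′) → ij ≡ ij′
    inj {i , j} {i′ , j′} ij∈ ij′∈ eq with refl ← Fin.toℕ-injective eq
      with left≡ , after ← peakEdge⇒peak (proj₁ (member ij∈))
         | left≡′ , after′ ← peakEdge⇒peak (proj₁ (member ij′∈))
      with <-cmp (toℕ j) (toℕ j′)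
    ... | tri< j<j′ _ _ = contradiction (after j′ j<j′) (<-irrefl (sym left≡′))
    ... | tri≈ _ j≡j′ _ = cong (i ,_) (Fin.toℕ-injective j≡j′)
    ... | tri> _ _ j′<j = contradiction (after′ j j′<j) (<-irrefl (sym left≡))
    onto : ∀ {z} → z ∈ opens 0 (reflect 0 a) v → ∃ λ ij → ij ∈ cliques × toℕ (proj₁ ij) ≡ z
    onto z∈ with z≤v , j₀ , v≤j₀ , refl ← ∈-opens⁻ (reflect 0 a) v z∈
      with j , j₀≤j , left≡left , last ← lastOccurrence (reflect 0 a) j₀
         | i , i≡ ← vertex (≤-<-trans (left-≤ j₀) (Fin.toℕ<n j₀)) =
      (i , j) ,
      ∈-filter⁺ (inPeakClique? a v) (∈-cartesianProduct⁺ (∈-allFin i) (∈-allFin j))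
        (peak⇒peakEdge (left≡i , after) , ≤-trans (≤-reflexive i≡) z≤v , ≤-trans v≤j₀ j₀≤j) ,
      i≡
      where
      left≡i : left j ≡ toℕ i
      left≡i = trans left≡left (sym i≡)
      after : ∀ k → j Fin.< k → toℕ i < left k
      after k j<k = ≤∧≢⇒< (≤-trans (≤-reflexive (sym left≡i)) (left-mono {j} {k} (<⇒≤ j<k)))
        (λ i≡left → last k j<k (trans (sym i≡left) i≡))

  pnest≡nesting : pnest a ≡ nesting 0 (reflect 0 a)
  pnest≡nesting = trans
    (cong (maxℕ 0) (trans (map-cong peakNesting≡ (allFin n)) (map-tabulate id _)))
    (nesting-max 0 (reflect 0 a))

  -- If ℓᵢ = i, no edge leads from the vertices i, i + 1, ... to an earlier one, so no walk from i
  -- reaches the first vertex.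
  connected⇒left< : Connected a → ∀ i → 0 < toℕ i → left i < toℕ i
  connected⇒left< conn i 0<i with vertex (<-trans 0<i (Fin.toℕ<n i))
  ... | o , o≡0 =
    ≰⇒> (λ i≤left → <⇒≱ 0<i (≤-trans (stays i≤left (conn i o) ≤-refl) (≤-reflexive o≡0)))
    where
    stays : toℕ i ≤ left i → ∀ {x y} → Star (Edge a) x y → toℕ i ≤ toℕ x → toℕ i ≤ toℕ y
    stays i≤left ε                       i≤x = i≤x
    stays i≤left (inj₁ (x<y , _) ◅ walk) i≤x = stays i≤left walk (≤-trans i≤x (<⇒≤ x<y))
    stays i≤left (inj₂ e ◅ walk)         i≤x =
      stays i≤left walk (≤-trans i≤left (≤-trans (left-mono i≤x) (edge⁻ e)))

  -- Consecutive vertices are adjacent, so one can walk down one vertex at a time; upward walks are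
  -- reversed downward ones.
  left<⇒connected : (∀ i → 0 < toℕ i → left i < toℕ i) → Connected a
  left<⇒connected left< x y = [ down , reverse Sum.swap ∘ down ]′ (≤-total (toℕ y) (toℕ x))
    where
    descend : ∀ d {x y} → toℕ x ≡ d + toℕ y → Star (Edge a) x y
    descend zero    eq with refl ← Fin.toℕ-injective eq = ε
    descend (suc d) {x} eq
      with w , w≡ ← vertex (≤-trans (≤-reflexive (sym eq)) (<⇒≤ (Fin.toℕ<n x))) =
      inj₂ (edge⁺ (≤-reflexive 1+w≡x) left≤w) ◅ descend d w≡
      where
      1+w≡x : suc (toℕ w) ≡ toℕ x
      1+w≡x = trans (cong suc w≡) (sym eq)
      left≤w : left x ≤ toℕ w
      left≤w = ≤-pred (≤-trans (left< x (≤-trans (s≤s z≤n) (≤-reflexive 1+w≡x)))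
        (≤-reflexive (sym 1+w≡x)))
    down : ∀ {x y} → y Fin.≤ x → Star (Edge a) x y
    down {x} {y} y≤x = descend (toℕ x ∸ toℕ y) (sym (m∸n+n≡m y≤x))

linked⁺ : ∀ (l : Vec ℕ m) → (∀ i → lookup l i < v + toℕ i) → Linked v l
linked⁺         []      l< = tt
linked⁺ {v = v} (x ∷ l) l< = subst (x <_) (+-identityʳ v) (l< zero) ,
  linked⁺ l (λ i → subst (lookup l i <_) (+-suc v (toℕ i)) (l< (suc i)))

linked⁻ : ∀ (l : Vec ℕ m) → Linked v l → ∀ i → lookup l i < v + toℕ i
linked⁻ {v = v} (x ∷ l) (x<v , _)  zero    = subst (x <_) (sym (+-identityʳ v)) x<v
linked⁻ {v = v} (x ∷ l) (_ , lk)   (suc i) =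
  subst (lookup l i <_) (sym (+-suc v (toℕ i))) (linked⁻ l lk i)

-- The bijection with Dyck paths

DP-unique : ∀ n → Unique (DP n)
DP-unique n = Unique.filter⁺ isAreaSequence? (words-unique (Unique.upTo⁺ n) n)

∈-DP⁺ : ∀ (a : Vec ℕ n) → IsAreaSequence a → a ∈ DP n
∈-DP⁺ a ia = ∈-filter⁺ isAreaSequence?
  (∈-words⁺ (VecAll.lookup⁻ (λ i → ∈-upTo⁺ (≤-<-trans (area-≤ a ia i) (Fin.toℕ<n i))))) ia

∈-DP⁻ : ∀ (a : Vec ℕ n) → a ∈ DP n → IsAreaSequence a
∈-DP⁻ {n} a a∈ = proj₂ (∈-filter⁻ isAreaSequence? {xs = words (upTo n) n} a∈)

toPath : Vec ℕ n → Vec Step (n * 2)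
toPath a = path 0 (reflect 0 a)

toArea : ∀ n → Vec Step (n * 2) → Vec ℕ n
toArea n p = reflect 0 (leftEnds n 0 [] p)

queue₀ : ∀ (l : Vec ℕ m) → Queue 0 [] l
queue₀ l = record { sorted = [] ; sound = λ () ; found = λ _ () }

module _ (a : Vec ℕ n) (ia : IsAreaSequence a) where

  toPath-dyck : Dyckℕ 0 (toPath a)
  toPath-dyck = path-dyck (reflect 0 a) (area⇒leftEnds a ia) (queue₀ _)

  toArea-toPath : toArea n (toPath a) ≡ a
  toArea-toPath = trans
    (cong (reflect 0) (leftEnds-path (reflect 0 a) (area⇒leftEnds a ia) (queue₀ _)))
    (reflect-involutive a (area-≤ a ia))

  pnest-toPath : pnest a ≡ ⌈ top 0 (toPath a) /2⌉
  pnest-toPath = trans (pnest≡nesting a ia)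
    (sym (path-top (reflect 0 a) (area⇒leftEnds a ia) (queue₀ _)))

module _ n (p : Vec Step (n * 2)) (d : Dyckℕ 0 p) where

  decoded : Decoded 0 0 [] p (leftEnds n 0 [] p)
  decoded = decode n p [] [] [] z≤n d

  toArea-isArea : IsAreaSequence (toArea n p)
  toArea-isArea = leftEnds⇒area _ (decoded .leftEnds!)

  toPath-toArea : toPath (toArea n p) ≡ p
  toPath-toArea = trans
    (cong (path 0) (reflect-involutive (leftEnds n 0 [] p) (leftEnds-≤ _ (decoded .leftEnds!))))
    (decoded .path!)

-- Connected graphs and paths of the form U p D

prime⇒dyck : ∀ {l} h (p : Vec Step l) → Prime h p → Dyckℕ h p
prime⇒dyck h       []      pr = pr
prime⇒dyck (suc h) (U ∷ p) pr = prime⇒dyck (suc (suc h)) p pr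
prime⇒dyck (suc h) (D ∷ p) pr = prime⇒dyck h p pr

-- Raised by 1, a Dyck path stays above the axis until the added step.
prime-∷ʳ⁺ : ∀ {l} h (p : Vec Step l) → Dyckℕ h p → Prime (suc h) (p ∷ʳ D)
prime-∷ʳ⁺ h       []      d = d
prime-∷ʳ⁺ h       (U ∷ p) d = prime-∷ʳ⁺ (suc h) p d
prime-∷ʳ⁺ (suc h) (D ∷ p) d = prime-∷ʳ⁺ h p d

-- The last step comes down from height 1; without it, and lowered by 1, the path is Dyck.
prime-∷ʳ⁻ : ∀ {l} h (p : Vec Step (suc l)) → Prime (suc h) p → ∃ λ p′ → Dyckℕ h p′ × p′ ∷ʳ D ≡ p
prime-∷ʳ⁻ h (D ∷ [])        pr = [] , pr , refl
prime-∷ʳ⁻ h (U ∷ p@(_ ∷ _)) pr with p′ , d , eq ← prime-∷ʳ⁻ (suc h) p pr =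
  U ∷ p′ , d , cong (U ∷_) eq
prime-∷ʳ⁻ (suc h) (D ∷ p@(_ ∷ _)) pr with p′ , d , eq ← prime-∷ʳ⁻ h p pr =
  D ∷ p′ , d , cong (D ∷_) eq

top-∷ʳ : ∀ {l} h (p : Vec Step l) → Dyckℕ h p → top (suc h) (p ∷ʳ D) ≡ suc (top h p)
top-∷ʳ h       []      refl = refl
top-∷ʳ h       (U ∷ p) d    = cong (suc h ⊔_) (top-∷ʳ (suc h) p d)
top-∷ʳ (suc h) (D ∷ p) d    = cong (suc (suc h) ⊔_) (top-∷ʳ h p d)

start≤top : ∀ {l} h (p : Vec Step l) → h ≤ top h p
start≤top h []      = ≤-refl
start≤top h (U ∷ p) = m≤m⊔n h _
start≤top h (D ∷ p) = m≤m⊔n h _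

-- The path starts on the axis, where `prime-step` does not apply. So the first vertex is treated by
-- hand: its `U` is stripped off and its queue is `0 ∷ []`.
first-prime : ∀ (l : Vec ℕ m) → Prime 1 (mark 0 l ∷ path 1 l) ≡
              Prime (length (pop (mark 0 l) (0 ∷ [])) * 2) (path 1 l)
first-prime l with mark 0 l
... | U = refl
... | D = refl

queue₁ : ∀ (l : Vec ℕ m) → Queue 1 (pop (mark 0 l) (0 ∷ [])) l
queue₁ l = queue-pop l record
  { sorted = [] ∷ []
  ; sound  = λ { (here refl) → hereᵥ refl , s≤s z≤n }
  ; found  = λ { {zero} _ _ → here refl ; {suc _} _ (s≤s ()) } }

module _ (x : ℕ) (a : Vec ℕ m) (ia : IsAreaSequence (x ∷ a)) where

  private
    lefts : Vec ℕ m
    lefts = reflect 1 a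

    ok : LeftEnds 1 (0 ∸ x) lefts
    ok = proj₂ (proj₂ (area⇒leftEnds (x ∷ a) ia))

  afterFirst : Vec Step (suc (m * 2))
  afterFirst = mark 0 lefts ∷ path 1 lefts

  toPath-∷ : toPath (x ∷ a) ≡ U ∷ afterFirst
  toPath-∷ = trans (cong (λ y → path 0 (y ∷ lefts)) (0∸n≡0 x))
    (cong (_∷ afterFirst) (mark-∈ 0 (0 ∷ lefts) (hereᵥ refl)))

  connected⇒prime : Connected (x ∷ a) → Prime 1 afterFirst
  connected⇒prime conn = subst id (sym (first-prime lefts)) (path-prime⁺ lefts ok (queue₁ lefts)
    (linked⁺ lefts (λ i → connected⇒left< (x ∷ a) ia conn (suc i) (s≤s z≤n))))

  prime⇒connected : Prime 1 afterFirst → Connected (x ∷ a)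
  prime⇒connected pr = left<⇒connected (x ∷ a) ia λ { (suc i) _ →
    linked⁻ lefts (path-prime⁻ lefts ok (queue₁ lefts) (subst id (first-prime lefts) pr)) i }

-- The distribution of pnest, for all graphs and for connected ones

module _ {n l} (embed : Vec Step l → Vec Step (n * 2)) (g : ℕ → ℕ) (Good : Vec ℕ n → Set)
  (areas : List (Vec ℕ n)) (areas! : Unique areas)
  (∈-areas⁺ : ∀ a → IsAreaSequence a → Good a → a ∈ areas)
  (∈-areas⁻ : ∀ a → a ∈ areas → IsAreaSequence a × Good a)
  (embed-dyck : ∀ p → Dyckℕ 0 p → Dyckℕ 0 (embed p))
  (embed-top : ∀ p → Dyckℕ 0 p → ⌈ top 0 (embed p) /2⌉ ≡ g (top 0 p))
  (embed-injective : ∀ p p′ → embed p ≡ embed p′ → p ≡ p′)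
  (embed-good : ∀ p → Dyckℕ 0 p → Good (toArea n (embed p)))
  (embed-onto : ∀ a → IsAreaSequence a → Good a → ∃ λ p → Dyckℕ 0 p × embed p ≡ toPath a)
  where

  -- The bijection is p ↦ `toArea n (embed p)`. For all area sequences `embed` is the identity, for
  -- the connected ones it is p ↦ U p D, and `g` is what half the height, rounded up, becomes in
  -- terms of p.
  pnest-distribution : ∀ k →
    ∑ areas (λ a → 1 ·t^ pnest a) k ≡ length (filter (dyckWith? g k) (paths l))
  pnest-distribution k = trans (∑-monomials pnest areas k)
    (sym (bijection⇒length≡ (toArea n ∘ embed)
    (Unique.filter⁺ (dyckWith? g k) (paths-unique l))
    (Unique.filter⁺ (λ a → k ≟ pnest a) areas!)
    (into _) (inj _ _) (onto _)))
    where
    ps : List (Vec Step l)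
    ps = filter (dyckWith? g k) (paths l)
    as : List (Vec ℕ n)
    as = filter (λ a → k ≟ pnest a) areas
    member : ∀ p → p ∈ ps → DyckWith g k p
    member p p∈ = proj₂ (∈-filter⁻ (dyckWith? g k) {xs = paths l} p∈)
    encode-decode : ∀ p → Dyckℕ 0 p → toPath (toArea n (embed p)) ≡ embed p
    encode-decode p d = toPath-toArea n (embed p) (embed-dyck p d)
    into : ∀ p → p ∈ ps → toArea n (embed p) ∈ as
    into p p∈ with d , k≡ ← member p p∈ =
      ∈-filter⁺ (λ a → k ≟ pnest a) (∈-areas⁺ a ia (embed-good p d))
        (trans k≡ (trans (sym (embed-top p d))
          (trans (cong (⌈_/2⌉ ∘ top 0) (sym (encode-decode p d))) (sym (pnest-toPath a ia)))))
      where
      a : Vec ℕ n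
      a = toArea n (embed p)
      ia : IsAreaSequence a
      ia = toArea-isArea n (embed p) (embed-dyck p d)
    inj : ∀ p p′ → p ∈ ps → p′ ∈ ps → toArea n (embed p) ≡ toArea n (embed p′) → p ≡ p′
    inj p p′ p∈ p′∈ eq = embed-injective p p′
      (trans (sym (encode-decode p (proj₁ (member p p∈))))
        (trans (cong toPath eq) (encode-decode p′ (proj₁ (member p′ p′∈)))))
    onto : ∀ a → a ∈ as → ∃ λ p → p ∈ ps × toArea n (embed p) ≡ a
    onto a a∈ with a∈areas , k≡ ← ∈-filter⁻ (λ a → k ≟ pnest a) {xs = areas} a∈
      with ia , good ← ∈-areas⁻ a a∈areas
      with p , d , eq ← embed-onto a ia good =
      p ,
      ∈-filter⁺ (dyckWith? g k) (∈-paths p)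
        (d , trans k≡ (trans (pnest-toPath a ia)
          (trans (cong (⌈_/2⌉ ∘ top 0) (sym eq)) (embed-top p d)))) ,
      trans (cong (toArea n) eq) (toArea-toPath a ia)

Pnest-paths : ∀ n k → Pnest n k ≡ length (filter (dyckWith? ⌈_/2⌉ k) (paths (n * 2)))
Pnest-paths n = pnest-distribution id ⌈_/2⌉ (λ _ → ⊤) (DP n) (DP-unique n)
  (λ a ia _ → ∈-DP⁺ a ia) (λ a a∈ → ∈-DP⁻ a a∈ , tt)
  (λ _ d → d) (λ _ _ → refl) (λ _ _ eq → eq) (λ _ _ → tt)
  (λ a ia _ → toPath a , toPath-dyck a ia , refl)

wrap : ∀ {l} → Vec Step l → Vec Step (2 + l)
wrap p = U ∷ (p ∷ʳ D)

wrap-dyck : ∀ {l} (p : Vec Step l) → Dyckℕ 0 p → Dyckℕ 0 (wrap p)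
wrap-dyck p d = prime⇒dyck 1 (p ∷ʳ D) (prime-∷ʳ⁺ 0 p d)

wrap-connected : ∀ m (p : Vec Step (m * 2)) → Dyckℕ 0 p → Connected (toArea (suc m) (wrap p))
wrap-connected m p d = go (toArea (suc m) (wrap p))
  (toArea-isArea (suc m) (wrap p) (wrap-dyck p d)) (toPath-toArea (suc m) (wrap p) (wrap-dyck p d))
  where
  -- Generalised to a variable `a`, which can be split into its first entry and the rest.
  go : ∀ (a : Vec ℕ (suc m)) → IsAreaSequence a → toPath a ≡ wrap p → Connected a
  go (x ∷ a) ia eq = prime⇒connected x a ia
    (subst (Prime 1) (∷-injectiveʳ (trans (sym eq) (toPath-∷ x a ia))) (prime-∷ʳ⁺ 0 p d))

unwrap : ∀ (a : Vec ℕ (suc m)) → IsAreaSequence a → Connected a →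
         ∃ λ p → Dyckℕ 0 p × wrap p ≡ toPath a
unwrap (x ∷ a) ia conn
  with p , d , eq ← prime-∷ʳ⁻ 0 (afterFirst x a ia) (connected⇒prime x a ia conn) =
  p , d , trans (cong (U ∷_) eq) (sym (toPath-∷ x a ia))

Pnestᶜ-paths : ∀ m k →
  Pnestᶜ (suc m) k ≡ length (filter (dyckWith? (suc ∘ ⌊_/2⌋) k) (paths (m * 2)))
Pnestᶜ-paths m = pnest-distribution wrap (suc ∘ ⌊_/2⌋) Connected
  (filter connected? (DP (suc m))) (Unique.filter⁺ connected? (DP-unique (suc m)))
  (λ a ia conn → ∈-filter⁺ connected? (∈-DP⁺ a ia) conn)
  (λ a a∈ → let a∈DP , conn = ∈-filter⁻ connected? {xs = DP (suc m)} a∈ in ∈-DP⁻ a a∈DP , conn)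
  -- Wrapping raises the height by 1, and `⌈ suc h /2⌉` computes to `suc ⌊ h /2⌋`.
  wrap-dyck (λ p d → cong ⌈_/2⌉ (top-∷ʳ 0 p d))
  (λ p p′ eq → ∷ʳ-injectiveˡ p p′ (∷-injectiveʳ eq))
  (wrap-connected m) unwrap

corollary3p13 : ∀ (n : ℕ) → 1 ≤ n →
    (Pnest n ≗ ∑ [1⋯ ⌈ n /2⌉ ] (λ i → (H n (2 * i ∸ 1) + H n (2 * i)) ·t^ i))
    × (Pnestᶜ n ≗ ∑ [1⋯ ⌈ n /2⌉ ] (λ i → (H (n ∸ 1) (2 * i ∸ 2) + H (n ∸ 1) (2 * i ∸ 1)) ·t^ i))
corollary3p13 n@(suc m) _ =
  ∑-coefficients _ ⌈ n /2⌉ (Pnest n)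
    (λ { (suc i) _ → trans (Pnest-paths n (suc i)) (sym (H-pair-⌈/2⌉ n i)) })
    (trans (Pnest-paths n 0) (filter-empty (dyckWith? ⌈_/2⌉ 0) {paths (n * 2)}
      (λ {p} _ → no-zero p)))
    (λ k >k → trans (Pnest-paths n k) (filter-empty (dyckWith? ⌈_/2⌉ k) {paths (n * 2)}
      (λ { {p} _ (d , refl) → <⇒≱ >k (⌈n/2⌉-mono (top≤semilength n p d)) }))) ,
  ∑-coefficients _ ⌈ n /2⌉ (Pnestᶜ n)
    (λ { (suc i) _ → trans (Pnestᶜ-paths m (suc i)) (sym (H-pair-⌊/2⌋ m i)) })
    (trans (Pnestᶜ-paths m 0) (filter-empty (dyckWith? (suc ∘ ⌊_/2⌋) 0) {paths (m * 2)}
      (λ { _ (_ , ()) })))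
    (λ k >k → trans (Pnestᶜ-paths m k) (filter-empty (dyckWith? (suc ∘ ⌊_/2⌋) k) {paths (m * 2)}
      -- As n = m + 1, the bound `suc ⌊ m /2⌋` is `⌈ n /2⌉` by computation.
      (λ { {p} _ (d , refl) → <⇒≱ >k (s≤s (⌊n/2⌋-mono (top≤semilength m p d))) })))
  where
  no-zero : ∀ (p : Vec Step (n * 2)) → ¬ DyckWith ⌈_/2⌉ 0 p
  -- As n ≥ 1, the path has a first step, necessarily `U`, and so reaches height 1.
  no-zero (U ∷ p) (_ , 0≡) = <⇒≱ (⌈n/2⌉-mono (start≤top 1 p)) (≤-reflexive (sym 0≡))
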